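{- Assume the Continuum Hypothesis. Let $\langle\mathbb A,\sigma\restriction\mathbb A\rangle$ be a countable elementary substructure of $\langle\mathcal P(\omega)/\mathrm{Fin},\sigma\rangle$, and let $\eta$ be an embedding of $\langle\mathbb A,\sigma\restriction\mathbb A\rangle$ into $\langle\mathcal P(\omega)/\mathrm{Fin},\sigma\rangle$. Then there is an automorphism $\phi$ of $\mathcal P(\omega)/\mathrm{Fin}$ with $\phi\circ\sigma=\sigma\circ\phi$ and $\phi\restriction\mathbb A=\eta$.
   Context: $\mathcal P(\omega)/\mathrm{Fin}$ is $\mathcal P(\omega)$ modulo finite sets, $\sigma([A])=[A+1]$. An embedding of $\langle\mathbb A,\alpha\rangle$ into $\langle\mathbb B,\beta\rangle$ is an injective Boolean homomorphism $\eta$ with $\eta\circ\alpha=\beta\circ\eta$. An elementary substructure is a subalgebra closed under $\sigma,\sigma^{ -1}$ in which every first-order formula with parameters from it (language: constants $\mathbf 0,\mathbf 1$, Boolean operations, $\le$, unary symbols for the automorphism and its inverse) has the same truth value as in $\langle\mathcal P(\omega)/\mathrm{Fin},\sigma\rangle$. -}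

module Defs where

open import Data.Nat using (ℕ; zero; suc; _≥_)
open import Data.Bool using (Bool; true; false; _∧_; _∨_; not)
open import Data.Product using (Σ; ∃; _×_; _,_)
open import Data.Sum using (_⊎_)
open import Data.Unit using (⊤)
open import Data.Empty using (⊥)
open import Relation.Nullary using (Dec; ¬_)
open import Relation.Binary.PropositionalEquality using (_≡_)
open import Induction.WellFounded using (WellFounded)

Subset : Set
Subset = ℕ → Bool

_=*_ : Subset → Subset → Set
A =* B = ∃ λ N → ∀ n → n ≥ N → A n ≡ B n

_≗ˢ_ : Subset → Subset → Set
A ≗ˢ B = ∀ n → A n ≡ B n

-- Boolean operations (they respect =*, so they induce the operations of P(ω)/Fin)
𝟎 𝟏 : Subset
𝟎 _ = false
𝟏 _ = true

_⊓_ _⊔_ : Subset → Subset → Subset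
(A ⊓ B) n = A n ∧ B n
(A ⊔ B) n = A n ∨ B n

∁ : Subset → Subset
∁ A n = not (A n)

_≤*_ : Subset → Subset → Set
A ≤* B = (A ⊓ ∁ B) =* 𝟎

σ : Subset → Subset
σ A zero    = false
σ A (suc n) = A n

σ⁻¹ : Subset → Subset
σ⁻¹ A n = A (suc n)

data Term : Set where
  var       : ℕ → Term
  zeroᵗ oneᵗ : Term
  _⊓ᵗ_ _⊔ᵗ_ : Term → Term → Term
  ∁ᵗ        : Term → Term
  σᵗ σ⁻¹ᵗ   : Term → Term

data Formula : Set where
  _≐_ _≤ᶠ_       : Term → Term → Formula
  ⊥ᶠ             : Formula
  ¬ᶠ             : Formula → Formula
  _∧ᶠ_ _∨ᶠ_ _⇒ᶠ_ : Formula → Formula → Formula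
  ∀ᶠ ∃ᶠ          : Formula → Formula

Valuation : Set
Valuation = ℕ → Subset

_∷ᵛ_ : Subset → Valuation → Valuation
(x ∷ᵛ ρ) zero    = x
(x ∷ᵛ ρ) (suc i) = ρ i

⟦_⟧ᵗ : Term → Valuation → Subset
⟦ var i ⟧ᵗ ρ   = ρ i
⟦ zeroᵗ ⟧ᵗ ρ   = 𝟎
⟦ oneᵗ ⟧ᵗ ρ    = 𝟏
⟦ s ⊓ᵗ t ⟧ᵗ ρ  = ⟦ s ⟧ᵗ ρ ⊓ ⟦ t ⟧ᵗ ρ
⟦ s ⊔ᵗ t ⟧ᵗ ρ  = ⟦ s ⟧ᵗ ρ ⊔ ⟦ t ⟧ᵗ ρ
⟦ ∁ᵗ t ⟧ᵗ ρ    = ∁ (⟦ t ⟧ᵗ ρ)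
⟦ σᵗ t ⟧ᵗ ρ    = σ (⟦ t ⟧ᵗ ρ)
⟦ σ⁻¹ᵗ t ⟧ᵗ ρ  = σ⁻¹ (⟦ t ⟧ᵗ ρ)

-- Satisfaction in the substructure of ⟨P(ω)/Fin, σ⟩ whose universe is
-- (the =*-classes of) the subsets satisfying D; quantifiers range over D.
Sat : (Subset → Set) → Valuation → Formula → Set
Sat D ρ (s ≐ t)   = ⟦ s ⟧ᵗ ρ =* ⟦ t ⟧ᵗ ρ
Sat D ρ (s ≤ᶠ t)  = ⟦ s ⟧ᵗ ρ ≤* ⟦ t ⟧ᵗ ρ
Sat D ρ ⊥ᶠ        = ⊥
Sat D ρ (¬ᶠ φ)    = ¬ Sat D ρ φ
Sat D ρ (φ ∧ᶠ ψ)  = Sat D ρ φ × Sat D ρ ψ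
Sat D ρ (φ ∨ᶠ ψ)  = Sat D ρ φ ⊎ Sat D ρ ψ
Sat D ρ (φ ⇒ᶠ ψ)  = Sat D ρ φ → Sat D ρ ψ
Sat D ρ (∀ᶠ φ)    = (x : Subset) → D x → Sat D (x ∷ᵛ ρ) φ
Sat D ρ (∃ᶠ φ)    = Σ Subset λ x → D x × Sat D (x ∷ᵛ ρ) φ

Full : Subset → Set
Full _ = ⊤

-- Countable elementary substructures.
-- The substructure 𝔸 is given by an enumeration a : ℕ → Subset of
-- representatives; its universe is {[x] | ∃ n. x =* a n}.
-- (𝔸 contains 𝟎, so it is nonempty; every countable nonempty set has such
-- an enumeration.)

In : (ℕ → Subset) → Subset → Set
In a x = ∃ λ n → x =* a n

record IsElementarySubstructure (a : ℕ → Subset) : Set where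
  field
    has-𝟎   : In a 𝟎
    has-𝟏   : In a 𝟏
    close-⊓ : ∀ x y → In a x → In a y → In a (x ⊓ y)
    close-⊔ : ∀ x y → In a x → In a y → In a (x ⊔ y)
    close-∁ : ∀ x → In a x → In a (∁ x)
    close-σ   : ∀ x → In a x → In a (σ x)
    close-σ⁻¹ : ∀ x → In a x → In a (σ⁻¹ x)
    elementary : ∀ (φ : Formula) (ρ : Valuation) → (∀ i → In a (ρ i)) →
                 (Sat (In a) ρ φ → Sat Full ρ φ) × (Sat Full ρ φ → Sat (In a) ρ φ)

-- Embeddings of ⟨𝔸, σ↾𝔸⟩ into ⟨P(ω)/Fin, σ⟩.  η is a map on representatives;
-- only its behaviour on (representatives of elements of) 𝔸 matters.

record IsEmbedding (a : ℕ → Subset) (η : Subset → Subset) : Set where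
  field
    well-defined : ∀ x y → In a x → In a y → x =* y → η x =* η y
    injective    : ∀ x y → In a x → In a y → η x =* η y → x =* y
    pres-𝟎 : η 𝟎 =* 𝟎
    pres-𝟏 : η 𝟏 =* 𝟏
    pres-⊓ : ∀ x y → In a x → In a y → η (x ⊓ y) =* (η x ⊓ η y)
    pres-⊔ : ∀ x y → In a x → In a y → η (x ⊔ y) =* (η x ⊔ η y)
    pres-∁ : ∀ x → In a x → η (∁ x) =* ∁ (η x)
    comm-σ : ∀ x → In a x → η (σ x) =* σ (η x)

record IsShiftAutomorphism (φ : Subset → Subset) : Set where
  field
    well-defined : ∀ x y → x =* y → φ x =* φ y
    injective    : ∀ x y → φ x =* φ y → x =* y
    surjective   : ∀ y → ∃ λ x → φ x =* y
    pres-𝟎 : φ 𝟎 =* 𝟎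
    pres-𝟏 : φ 𝟏 =* 𝟏
    pres-⊓ : ∀ x y → φ (x ⊓ y) =* (φ x ⊓ φ y)
    pres-⊔ : ∀ x y → φ (x ⊔ y) =* (φ x ⊔ φ y)
    pres-∁ : ∀ x → φ (∁ x) =* ∁ (φ x)
    comm-σ : ∀ x → φ (σ x) =* σ (φ x)

-- Classical logic (the ambient metatheory of the paper is ZFC).
ExcludedMiddle : Set₁
ExcludedMiddle = (P : Set) → Dec P

-- The Continuum Hypothesis 2^ℵ₀ = ℵ₁, in the form: P(ω) carries a
-- well-ordering (total up to pointwise equality) all of whose proper
-- initial segments are countable.
CH : Set₁
CH = Σ (Subset → Subset → Set) λ _≺_ →
       WellFounded _≺_ ×
       (∀ x y → x ≺ y ⊎ x ≗ˢ y ⊎ y ≺ x) ×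
       (∀ y → Σ (ℕ → Subset) λ e → ∀ x → x ≺ y → ∃ λ n → e n ≗ˢ x)

{-# OPTIONS --safe #-}
-- Two countable subalgebras are matched by comparing, for finitely many members at a time, which
-- patterns of two consecutive columns occur infinitely often (≃).  Call a family rich if, for every
-- finite automaton reading its columns, it contains an infinite set D such that the automaton does the
-- same thing e, with e idempotent, between any two consecutive times of D, together with the record of
-- the runs.  Ramsey's theorem provides such a D in P(ω); hence elementary substructures are rich, and
-- every countable family lies in a countable rich one.  Richness only depends on the ≃-class.
--
-- Let u extend a rich family c, and let c ≃ c′.  Apply richness to the automaton recording which paths
-- through the graph of the recurring patterns of the first ℓ members of u are compatible with c.  By
-- idempotence u itself yields a loop at some node p that visits any prescribed recurring pattern, and the
-- loop is available over c′ between any two times of D.  Requiring the loops of one level to meet those of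
-- the previous level lets them be spliced together into a family v over c′ with u ≃ v.  The roles
-- of c and c′ are symmetric, so back and forth along the well-ordering of CH gives the automorphism.
module Submission where

open import Defs
open import Data.Nat hiding (_⊓_) renaming (_⊔_ to _⊔ℕ_)
open import Data.Nat.Properties
open import Data.Bool using (Bool; true; false; _∧_; _∨_; not; if_then_else_)
open import Data.Bool.Properties using (¬-not; ∨-identityʳ)
open import Data.Product using (Σ; ∃; _×_; _,_; proj₁; proj₂)
open import Data.Sum using (_⊎_; inj₁; inj₂; [_,_]′)
open import Data.Unit using (⊤; tt)
open import Data.Maybe using (Maybe; just; nothing)
open import Function using (_∘_; id)
open import Induction.WellFounded using (WellFounded; Acc; acc)
open import Relation.Binary.Construct.Closure.Transitive using (TransClosure; [_]; _∷_; wellFounded)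
open import Relation.Nullary using (Dec; yes; no; ¬_; does; contradiction)
open import Relation.Nullary.Decidable using (dec-true; decidable-stable)
open import Relation.Binary.Definitions using (tri<; tri≈; tri>)
open import Relation.Binary.PropositionalEquality

module Classical (em : ExcludedMiddle) where

  -- Classical logic, eventual and recurrent properties, Ramsey's theorem

  by-contradiction : {P : Set} → ¬ ¬ P → P
  by-contradiction {P} = decidable-stable (em P)

  char : Set → Bool
  char P = does (em P)

  char-in : {P : Set} → P → char P ≡ true
  char-in {P} = dec-true (em P)

  char-out : {P : Set} → char P ≡ true → P
  char-out {P} eq with em P
  ... | yes p = p
  ... | no _ with () ← eq

  Bool-ext : {x y : Bool} → (x ≡ true → y ≡ true) → (y ≡ true → x ≡ true) → x ≡ y
  Bool-ext {true}  {y}     f g = sym (f refl)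
  Bool-ext {false} {true}  f g = g refl
  Bool-ext {false} {false} f g = refl

  Ev IO : (ℕ → Set) → Set
  Ev P = Σ ℕ λ N → ∀ n → N ≤ n → P n
  IO P = ∀ N → Σ ℕ λ n → N ≤ n × P n

  module _ {P Q : ℕ → Set} where

    Ev-map : (∀ n → P n → Q n) → Ev P → Ev Q
    Ev-map f (N , h) = N , λ n N≤n → f n (h n N≤n)

    Ev-× : Ev P → Ev Q → Ev (λ n → P n × Q n)
    Ev-× (M , h) (N , k) = M ⊔ℕ N , λ n le →
      h n (≤-trans (m≤m⊔n M N) le) , k n (≤-trans (m≤n⊔m M N) le)

    IO-map : (∀ n → P n → Q n) → IO P → IO Q
    IO-map f h N with n , N≤n , p ← h N = n , N≤n , f n p

    Ev-IO : Ev P → IO Q → IO (λ n → P n × Q n)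
    Ev-IO (M , h) k N with n , le , q ← k (M ⊔ℕ N) =
      n , ≤-trans (m≤n⊔m M N) le , h n (≤-trans (m≤m⊔n M N) le) , q

  module _ {P : ℕ → Set} where

    Ev-suc : Ev P → Ev (P ∘ suc)
    Ev-suc (N , h) = N , λ n le → h (suc n) (m≤n⇒m≤1+n le)

    IO-suc : IO P → IO (P ∘ suc)
    IO-suc h N with suc n , s≤s le , p ← h (suc N) = n , le , p

    ¬IO→Ev¬ : ¬ IO P → Ev (λ n → ¬ P n)
    ¬IO→Ev¬ h = by-contradiction λ ¬ev → h λ N → by-contradiction λ ¬ex →
      ¬ev (N , λ n le p → ¬ex (n , le , p))

    ¬Ev¬→IO : ¬ Ev (λ n → ¬ P n) → IO P
    ¬Ev¬→IO h = by-contradiction (h ∘ ¬IO→Ev¬)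

  ¬Ev→IO¬ : {P : ℕ → Set} → ¬ Ev P → IO (λ n → ¬ P n)
  ¬Ev→IO¬ h = by-contradiction λ ¬io → h (Ev-map (λ n → by-contradiction) (¬IO→Ev¬ ¬io))

  Ev-< : {P : ℕ → ℕ → Set} (N : ℕ) → (∀ i → i < N → Ev (P i)) → Ev (λ n → ∀ i → i < N → P i n)
  Ev-< zero h = 0 , λ _ _ _ ()
  Ev-< {P} (suc N) h = Ev-map split (Ev-× (h N ≤-refl) (Ev-< N λ i i<N → h i (m≤n⇒m≤1+n i<N)))
    where
    split : ∀ n → P N n × (∀ i → i < N → P i n) → ∀ i → i < suc N → P i n
    split n (pN , p<) i i<sN with m<1+n⇒m<n∨m≡n i<sN
    ... | inj₁ i<N  = p< i i<N
    ... | inj₂ refl = pN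

  =*-refl : ∀ {A} → A =* A
  =*-refl = 0 , λ _ _ → refl

  =*-reflexive : ∀ {A B} → A ≡ B → A =* B
  =*-reflexive refl = =*-refl

  =*-sym : ∀ {A B} → A =* B → B =* A
  =*-sym = Ev-map λ _ → sym

  =*-trans : ∀ {A B C} → A =* B → B =* C → A =* C
  =*-trans A≈B B≈C = Ev-map (λ _ (p , q) → trans p q) (Ev-× A≈B B≈C)

  choose-below : ∀ k {R : ℕ → ℕ → Set} → (∀ j → j < k → Σ ℕ (R j)) → Σ (ℕ → ℕ) λ f → ∀ j → j < k → R j (f j)
  choose-below k {R} h = f , f-correct
    where
    f : ℕ → ℕ
    f j with j <? k
    ... | yes lt = proj₁ (h j lt)
    ... | no _   = 0

    f-correct : ∀ j → j < k → R j (f j)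
    f-correct j j<k with j <? k
    ... | yes lt = proj₂ (h j lt)
    ... | no j≮k = contradiction j<k j≮k

  -- A state is a column of a family of subsets: its values at one time.
  State : Set
  State = ℕ → Bool

  col : (ℕ → Subset) → ℕ → State
  col u t i = u i t

  infix 4 _≈[_]_

  _≈[_]_ : State → ℕ → State → Set
  x ≈[ k ] y = ∀ i → i < k → x i ≡ y i

  ≈-refl : ∀ {k x} → x ≈[ k ] x
  ≈-refl i _ = refl

  ≈-sym : ∀ {k x y} → x ≈[ k ] y → y ≈[ k ] x
  ≈-sym h i lt = sym (h i lt)

  ≈-trans : ∀ {k x y z} → x ≈[ k ] y → y ≈[ k ] z → x ≈[ k ] z
  ≈-trans g h i lt = trans (g i lt) (h i lt)

  ≈-≤ : ∀ {k l x y} → k ≤ l → x ≈[ l ] y → x ≈[ k ] y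
  ≈-≤ k≤l h i lt = h i (≤-trans lt k≤l)

  _[_≔_] : State → ℕ → Bool → State
  (x [ k ≔ b ]) i with i ≟ k
  ... | yes _ = b
  ... | no _  = x i

  ≈-[≔] : ∀ {k x p b} → x ≈[ k ] p → x k ≡ b → x ≈[ suc k ] (p [ k ≔ b ])
  ≈-[≔] {k} h e i lt with i ≟ k
  ... | yes refl = e
  ... | no i≢k   = h i (≤∧≢⇒< (≤-pred lt) i≢k)

  IO-or : {P Q : ℕ → Set} → IO (λ n → P n ⊎ Q n) → IO P ⊎ IO Q
  IO-or {P} {Q} h with em (IO P)
  ... | yes p = inj₁ p
  ... | no ¬p = inj₂ (IO-map (λ n → λ { (¬pn , inj₁ pn) → contradiction pn ¬pn ; (_ , inj₂ qn) → qn })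
                             (Ev-IO (¬IO→Ev¬ ¬p) h))

  -- Induction on `k`: one more bit splits the recurring times into two classes, one of which
  -- recurs.
  pigeonhole : ∀ {A : ℕ → Set} (x : ℕ → State) k → IO A → Σ State λ p → IO (λ t → A t × x t ≈[ k ] p)
  pigeonhole x zero io = (λ _ → false) , IO-map (λ t a → a , λ i ()) io
  pigeonhole {A} x (suc k) io with pigeonhole x k io
  ... | p , io′ with IO-or (IO-map split io′)
    where
    split : ∀ t → A t × x t ≈[ k ] p →
      (A t × x t ≈[ k ] p × x t k ≡ true) ⊎ (A t × x t ≈[ k ] p × x t k ≡ false)
    split t (a , h) with x t k
    ... | true  = inj₁ (a , h , refl)
    ... | false = inj₂ (a , h , refl)
  ... | res = [ extend true , extend false ]′ res
    where
    extend : ∀ b → IO (λ t → A t × x t ≈[ k ] p × x t k ≡ b) → Σ State λ q → IO (λ t → A t × x t ≈[ suc k ] q)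
    extend b io″ = p [ k ≔ b ] , IO-map (λ t (a , h , e) → a , ≈-[≔] h e) io″

  -- Ramsey's theorem for pairs

  _⊆_ : Subset → Subset → Set
  S ⊆ T = ∀ n → S n ≡ true → T n ≡ true

  Inf : Subset → Set
  Inf S = IO (λ n → S n ≡ true)

  Homogeneous : (ℕ → ℕ → Set) → Subset → Set
  Homogeneous R D = ∀ s t → D s ≡ true → D t ≡ true → s < t → R s t

  module Ramsey (f : ℕ → ℕ → Bool) where

    above : Subset → ℕ → Bool → Subset
    above T s b t = char (T t ≡ true × s < t × f s t ≡ b)

    Hereditary : Subset → Bool → Set
    Hereditary T₀ b = ∀ T → T ⊆ T₀ → Inf T → Σ ℕ λ s → T s ≡ true × Inf (above T s b)

    -- Greedy choice: a point with infinitely many later `b`-neighbours in the current pool is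
    -- taken, and the pool shrinks to these neighbours, so every later point is joined to it in
    -- colour `b`.
    homogeneous : ∀ T₀ b → Inf T₀ → Hereditary T₀ b →
      Σ Subset λ D → Inf D × D ⊆ T₀ × Homogeneous (λ s t → f s t ≡ b) D
    homogeneous T₀ b inf₀ rich = D , inf-D , D⊆T₀ , hom
      where
      Pool : Set
      Pool = Σ Subset λ T → T ⊆ T₀ × Inf T

      pick : Pool → ℕ
      pick (T , sub , inf) = proj₁ (rich T sub inf)

      next : Pool → Pool
      next (T , sub , inf) with s , _ , inf′ ← rich T sub inf =
        above T s b , (λ t h → sub t (proj₁ (char-out h))) , inf′

      pool : ℕ → Pool
      pool zero    = T₀ , (λ _ h → h) , inf₀
      pool (suc n) = next (pool n)

      pt : ℕ → ℕ
      pt n = pick (pool n)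

      pt∈ : ∀ n → proj₁ (pool n) (pt n) ≡ true
      pt∈ n with T , sub , inf ← pool n = proj₁ (proj₂ (rich T sub inf))

      pool-suc : ∀ n t → proj₁ (pool (suc n)) t ≡ true →
        proj₁ (pool n) t ≡ true × pt n < t × f (pt n) t ≡ b
      pool-suc n t h with T , sub , inf ← pool n = char-out h

      later : ∀ m n t → m < n → proj₁ (pool n) t ≡ true → pt m < t × f (pt m) t ≡ b
      later m (suc n) t m<sn h with m<1+n⇒m<n∨m≡n m<sn
      ... | inj₁ m<n  = later m n t m<n (proj₁ (pool-suc n t h))
      ... | inj₂ refl = proj₂ (pool-suc n t h)

      D : Subset
      D t = char (Σ ℕ λ n → pt n ≡ t)

      n≤pt : ∀ n → n ≤ pt n
      n≤pt zero    = z≤n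
      n≤pt (suc n) = ≤-<-trans (n≤pt n) (proj₁ (later n (suc n) _ ≤-refl (pt∈ (suc n))))

      inf-D : Inf D
      inf-D N = pt N , n≤pt N , char-in (N , refl)

      D⊆T₀ : D ⊆ T₀
      D⊆T₀ t h with n , refl ← char-out h = proj₁ (proj₂ (pool n)) _ (pt∈ n)

      hom : Homogeneous (λ s t → f s t ≡ b) D
      hom s t hs ht s<t with m , refl ← char-out hs | n , refl ← char-out ht with <-cmp m n
      ... | tri< m<n _ _    = proj₂ (later m n _ m<n (pt∈ n))
      ... | tri≈ _ refl _   = contradiction s<t (<-irrefl refl)
      ... | tri> _ _ n<m    = contradiction (proj₁ (later n m _ n<m (pt∈ m))) (<-asym s<t)

    finite-above→hereditary : ∀ T → (∀ s → T s ≡ true → ¬ Inf (above T s true)) → Hereditary T false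
    finite-above→hereditary T fin T′ T′⊆T inf with s , _ , s∈T′ ← inf 0 = s , s∈T′ ,
      IO-map (λ t ((¬true , s<t) , t∈T′) → char-in (t∈T′ , s<t , isFalse ¬true s<t (T′⊆T t t∈T′)))
        (Ev-IO (Ev-× (¬IO→Ev¬ (fin s (T′⊆T s s∈T′))) (suc s , λ _ s<t → s<t)) inf)
      where
      isFalse : ∀ {s t} → ¬ (above T s true t ≡ true) → s < t → T t ≡ true → f s t ≡ false
      isFalse ¬true s<t t∈T = ¬-not λ eq → ¬true (char-in (t∈T , s<t , eq))

    -- If `true` is not hereditary on `S`, some infinite `T` inside `S` has no point with infinitely
    -- many later `true`-neighbours in `T`. Each point of `T` is then joined to almost all later
    -- ones in colour `false`, which makes `false` hereditary on `T`.
    ramsey : ∀ S → Inf S →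
      Σ Subset λ D → Inf D × D ⊆ S × Σ Bool λ b → Homogeneous (λ s t → f s t ≡ b) D
    ramsey S inf with em (Hereditary S true)
    ... | yes her with D , inf-D , D⊆S , hom ← homogeneous S true inf her = D , inf-D , D⊆S , true , hom
    ... | no ¬her with em (Σ Subset λ T → T ⊆ S × Inf T × ∀ s → T s ≡ true → ¬ Inf (above T s true))
    ...   | no ¬ex = contradiction
              (λ T sub infT → by-contradiction λ ¬s → ¬ex (T , sub , infT , λ s s∈T io → ¬s (s , s∈T , io)))
              ¬her
    ...   | yes (T , T⊆S , infT , fin)
            with D , inf-D , D⊆T , hom ← homogeneous T false infT (finite-above→hereditary T fin)
            = D , inf-D , (λ n h → T⊆S n (D⊆T n h)) , false , hom

  -- One application of Ramsey's theorem per bit, each inside the homogeneous set of the previous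
  -- one.
  ramsey-states : (f : ℕ → ℕ → State) (N : ℕ) →
    Σ Subset λ D → Inf D × Σ State λ e → Homogeneous (λ s t → f s t ≈[ N ] e) D
  ramsey-states f zero = 𝟏 , (λ N → N , ≤-refl , refl) , (λ _ → false) , λ _ _ _ _ _ _ ()
  ramsey-states f (suc N)
    with D , inf , e , hom ← ramsey-states f N
    with D′ , inf′ , D′⊆D , b , hom′ ← Ramsey.ramsey (λ s t → f s t N) D inf
    = D′ , inf′ , (e [ N ≔ b ]) , λ s t hs ht s<t →
      ≈-[≔] (hom s t (D′⊆D s hs) (D′⊆D t ht) s<t) (hom′ s t hs ht s<t)

  -- Coding by natural numbers

  -- The value is `2 ^ a * (2 * b + 1) - 1`; its parity tells whether `a` is zero.
  pair : ℕ → ℕ → ℕ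
  pair zero    b = 2 * b
  pair (suc a) b = suc (2 * pair a b)

  pair-injective : ∀ a b a′ b′ → pair a b ≡ pair a′ b′ → a ≡ a′ × b ≡ b′
  pair-injective zero    b zero     b′ eq = refl , *-cancelˡ-≡ b b′ 2 eq
  pair-injective zero    b (suc a′) b′ eq = contradiction eq (even≢odd b (pair a′ b′))
  pair-injective (suc a) b zero     b′ eq = contradiction (sym eq) (even≢odd b′ (pair a b))
  pair-injective (suc a) b (suc a′) b′ eq
    with refl , b≡ ← pair-injective a b a′ b′ (*-cancelˡ-≡ (pair a b) (pair a′ b′) 2 (suc-injective eq)) = refl , b≡

  m≤pair : ∀ m n → m ≤ pair m n
  m≤pair zero    n = z≤n
  m≤pair (suc m) n = s≤s (≤-trans (m≤pair m n) (m≤m+n (pair m n) _))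

  opaque
    -- Numbers outside the range of pair are sent to (0 , 0).
    unpair : ℕ → ℕ × ℕ
    unpair n with em (Σ (ℕ × ℕ) λ (a , b) → pair a b ≡ n)
    ... | yes (ab , _) = ab
    ... | no _         = 0 , 0

    unpair-pair : ∀ a b → unpair (pair a b) ≡ (a , b)
    unpair-pair a b with em (Σ (ℕ × ℕ) λ (a′ , b′) → pair a′ b′ ≡ pair a b)
    ... | yes ((a′ , b′) , eq) with refl , refl ← pair-injective a′ b′ a b eq = refl
    ... | no ¬ex = contradiction ((a , b) , refl) ¬ex

  bit : Bool → ℕ
  bit false = 0
  bit true  = 1

  code : ℕ → State → ℕ
  code zero    x = 0
  code (suc k) x = pair (bit (x 0)) (code k (x ∘ suc))

  decode : ℕ → State
  decode m zero    = does (proj₁ (unpair m) ≟ 1)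
  decode m (suc i) = decode (proj₂ (unpair m)) i

  code-cong : ∀ k {x y} → x ≈[ k ] y → code k x ≡ code k y
  code-cong zero    h = refl
  code-cong (suc k) h = cong₂ pair (cong bit (h 0 (s≤s z≤n))) (code-cong k λ i lt → h (suc i) (s≤s lt))

  bit-injective : ∀ {a b} → bit a ≡ bit b → a ≡ b
  bit-injective {false} {false} _ = refl
  bit-injective {true}  {true}  _ = refl

  code-injective : ∀ k {x y} → code k x ≡ code k y → x ≈[ k ] y
  code-injective (suc k) {x} {y} eq i lt with pair-injective (bit (x 0)) _ (bit (y 0)) _ eq
  code-injective (suc k) eq zero    lt       | b≡ , _  = bit-injective b≡
  code-injective (suc k) eq (suc i) (s≤s lt) | _  , c≡ = code-injective k c≡ i lt

  decode-code : ∀ k x → decode (code k x) ≈[ k ] x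
  decode-code (suc k) x i lt with unpair (code (suc k) x) in eq
  ... | u with refl ← trans (sym eq) (unpair-pair (bit (x 0)) (code k (x ∘ suc))) with i | lt
  ...   | zero  | _      = trans (cong (λ v → does (proj₁ v ≟ 1)) eq) (unbit (x 0))
    where
    unbit : ∀ b → does (bit b ≟ 1) ≡ b
    unbit false = refl
    unbit true  = refl
  ...   | suc j | s≤s lt′ = trans (cong (λ v → decode (proj₂ v) j) eq) (decode-code k (x ∘ suc) j lt′)

  bounded : (f : ℕ → ℕ) (n : ℕ) → Σ ℕ λ K → ∀ i → i < n → f i < K
  bounded f zero    = 0 , λ _ ()
  bounded f (suc n) with K , h ← bounded f n = suc (f n ⊔ℕ K) , λ i lt → s≤s (bound i (m<1+n⇒m<n∨m≡n lt))
    where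
    bound : ∀ i → i < n ⊎ i ≡ n → f i ≤ f n ⊔ℕ K
    bound i (inj₁ i<n)  = ≤-trans (<⇒≤ (h i i<n)) (m≤n⊔m (f n) K)
    bound i (inj₂ refl) = m≤m⊔n (f n) K

  pair-bounded : ∀ m n → Σ ℕ λ K → ∀ a b → a < m → b < n → pair a b < K
  pair-bounded m n
    with L , h ← bounded (λ a → proj₁ (bounded (pair a) n)) m
    = L , λ a b a<m b<n → <-trans (proj₂ (bounded (pair a) n) b b<n) (h a a<m)

  code-bounded : ∀ k → Σ ℕ λ K → ∀ x → code k x < K
  code-bounded zero    = 1 , λ x → s≤s z≤n
  code-bounded (suc k) with K , h ← code-bounded k with L , h′ ← pair-bounded 2 K
    = L , λ x → h′ (bit (x 0)) _ (bit<2 (x 0)) (h (x ∘ suc))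
    where
    bit<2 : ∀ b → bit b < 2
    bit<2 false = s≤s z≤n
    bit<2 true  = s≤s (s≤s z≤n)

  Local₂ : ℕ → ℕ → ℕ → (State → State → State) → Set
  Local₂ k l n δ = ∀ {a a′ r r′} → a ≈[ k ] a′ → r ≈[ l ] r′ → δ a r ≈[ n ] δ a′ r′

  -- The local functions, up to agreement on the relevant entries, are listed by their tables.
  table : ℕ → ℕ → ℕ → State → State → State
  table k l m a r i = decode m (pair (code k a) (pair (code l r) i))

  -- The number `m` codes the bit string with `δ a r i` at the position coded from `a`, `r` and `i`;
  -- by locality the entry does not depend on the states chosen with these codes.
  table-complete : ∀ k l n δ → Local₂ k l n δ → Σ ℕ λ m → ∀ a r → table k l m a r ≈[ n ] δ a r
  table-complete k l n δ local
    with A , code-a ← code-bounded k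
    with R , code-r ← code-bounded l
    with L , pair-r ← pair-bounded R n
    with K , pair-a ← pair-bounded A L
    = code K f , λ a r i lt →
        trans (decode-code K f _ (pair-a _ _ (code-a a) (pair-r _ _ (code-r r) lt)))
              (Bool-ext (λ eq → entry a r i lt (char-out eq)) (λ eq → char-in (a , r , i , refl , eq)))
    where
    Entry : ℕ → Set
    Entry j = Σ State λ a → Σ State λ r → Σ ℕ λ i → j ≡ pair (code k a) (pair (code l r) i) × δ a r i ≡ true

    f : State
    f j = char (Entry j)

    entry : ∀ a r i → i < n → Entry (pair (code k a) (pair (code l r) i)) → δ a r i ≡ true
    entry a r i lt (a′ , r′ , i′ , eq , val)
      with a≡ , eq′ ← pair-injective (code k a) _ (code k a′) _ eq
      with r≡ , refl ← pair-injective (code l r) _ (code l r′) _ eq′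
      = trans (local (code-injective k a≡) (code-injective l r≡) i lt) val

  -- Automata and rich families

  -- A deterministic automaton on states of N bits, reading the first width bits of each letter.
  record Automaton (N : ℕ) : Set where
    field
      width : ℕ
      start : State
      step  : State → State → State
      local : Local₂ width N N step

    -- The letters read are those in `(s , t]`; for `t` up to `s` the value is `start`.
    run : (ℕ → State) → ℕ → ℕ → State
    run w s zero    = start
    run w s (suc t) with s ≤? t
    ... | yes _ = step (w (suc t)) (run w s t)
    ... | no _  = start

    run-start : ∀ w s → run w s s ≡ start
    run-start w zero = refl
    run-start w (suc s) with suc s ≤? s
    ... | yes ss≤s = contradiction ss≤s 1+n≰n
    ... | no _     = refl

    run-suc : ∀ w {s t} → s ≤ t → run w s (suc t) ≡ step (w (suc t)) (run w s t)
    run-suc w {s} {t} s≤t with s ≤? t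
    ... | yes _  = refl
    ... | no s≰t = contradiction s≤t s≰t

    -- States carry no multiplication, so idempotence is certified by a sample word: two adjacent
    -- stretches and their concatenation all lead from `start` to `e`.
    Idempotent : State → Set
    Idempotent e = Σ (ℕ → State) λ w → Σ ℕ λ r → Σ ℕ λ s → Σ ℕ λ t → r < s × s < t ×
      run w r s ≈[ N ] e × run w s t ≈[ N ] e × run w r t ≈[ N ] e

  open Automaton

  gap : Subset → ℕ → ℕ → Set
  gap D s t = ∀ r → s < r → r < t → D r ≡ false

  previous : ∀ D {s} t → D s ≡ true → s < t → Σ ℕ λ r → s ≤ r × r < t × D r ≡ true × gap D r t
  previous D {s} (suc t) s∈D (s≤s s≤t) with D t in eq
  ... | true = t , s≤t , ≤-refl , eq , λ r t<r r<st → contradiction (≤-trans t<r (≤-pred r<st)) 1+n≰n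
  ... | false with m≤n⇒m<n∨m≡n s≤t
  ...   | inj₂ refl with () ← trans (sym s∈D) eq
  ...   | inj₁ s<t with r , s≤r , r<t , r∈D , g ← previous D t s∈D s<t =
    r , s≤r , m≤n⇒m≤1+n r<t , r∈D , extend g
    where
    extend : ∀ {r} → gap D r t → gap D r (suc t)
    extend g q r<q q<st with m<1+n⇒m<n∨m≡n q<st
    ... | inj₁ q<t  = g q r<q q<t
    ... | inj₂ refl = eq

  -- Restarting at every time of `D` turns the record of runs into a condition on two consecutive
  -- columns, which transfers along `≃` and can be written as a term of the language.
  Tracks : ∀ {N} → Automaton N → (ℕ → State) → Subset → (ℕ → Subset) → ℕ → Set
  Tracks {N} A w D τ t = col τ (suc t) ≈[ N ] step A (w (suc t)) (if D t then start A else col τ t)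

  -- An infinite set D such that A runs from start to e between any two consecutive times of D,
  -- together with the record τ of these runs.
  record Witness {N} (A : Automaton N) (w : ℕ → State) (D : Subset) (τ : ℕ → Subset) (e : State) : Set where
    constructor witness
    field
      infinite   : Inf D
      tracks     : Ev (Tracks A w D τ)
      returns    : Ev (λ t → D t ≡ true → col τ t ≈[ N ] e)
      idempotent : Idempotent A e

  run-tracked : ∀ {N} (A : Automaton N) w D τ {M} → (∀ t → M ≤ t → Tracks A w D τ t) →
    ∀ {s} t → M ≤ s → D s ≡ true → s < t → gap D s t → col τ t ≈[ N ] run A w s t
  run-tracked A w D τ tr {s} (suc t) M≤s s∈D (s≤s s≤t) g
    rewrite run-suc A w s≤t with m≤n⇒m<n∨m≡n s≤t | tr t (≤-trans M≤s s≤t)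
  ... | inj₂ refl | h rewrite s∈D | run-start A w s = h
  ... | inj₁ s<t  | h rewrite g t s<t ≤-refl = ≈-trans h (local A ≈-refl
          (run-tracked A w D τ tr t M≤s s∈D s<t λ r s<r r<t → g r s<r (m≤n⇒m≤1+n r<t)))

  -- Ramsey's theorem is applied to the colouring of `s < t` by the state reached at `t` from `s`;
  -- three members of the homogeneous set give the idempotence.
  witness-exists : ∀ {N} (A : Automaton N) w → Σ Subset λ D → Σ (ℕ → Subset) λ τ → Σ State λ e → Witness A w D τ e
  witness-exists {N} A w with D , inf , e , hom ← ramsey-states (run A w) N
    = D , τ , e , witness inf (0 , λ t _ → ≈-refl) returns idem
    where
    states : ℕ → State
    states zero    = start A
    states (suc t) = step A (w (suc t)) (if D t then start A else states t)

    τ : ℕ → Subset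
    τ i t = states t i

    returns : Ev (λ t → D t ≡ true → col τ t ≈[ N ] e)
    returns with s , _ , s∈D ← inf 0 = suc s , λ t s<t t∈D → back t (previous D t s∈D s<t) t∈D
      where
      back : ∀ t → (Σ ℕ λ r → s ≤ r × r < t × D r ≡ true × gap D r t) → D t ≡ true → col τ t ≈[ N ] e
      back t (r , _ , r<t , r∈D , g) t∈D =
        ≈-trans (run-tracked A w D τ (λ _ _ → ≈-refl) t z≤n r∈D r<t g) (hom r t r∈D t∈D r<t)

    idem : Idempotent A e
    idem with r , _ , r∈D ← inf 0 with s , r<s , s∈D ← inf (suc r) with t , s<t , t∈D ← inf (suc s)
      = w , r , s , t , r<s , s<t , hom r s r∈D s∈D r<s , hom s t s∈D t∈D s<t , hom r t r∈D t∈D (<-trans r<s s<t)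

  module _ {N : ℕ} (A A′ : Automaton N) (f : ℕ → ℕ) (start≈ : start A′ ≈[ N ] start A)
           (step≈ : ∀ a r → step A′ a r ≈[ N ] step A (a ∘ f) r) where

    run-simulated : ∀ w s t → run A′ w s t ≈[ N ] run A (λ q → w q ∘ f) s t
    run-simulated w s zero = start≈
    run-simulated w s (suc t) with s ≤? t
    ... | yes _ = ≈-trans (step≈ _ _) (local A ≈-refl (run-simulated w s t))
    ... | no _  = start≈

    witness-simulated : ∀ {w D τ e} → Witness A′ w D τ e → Witness A (λ t → w t ∘ f) D τ e
    witness-simulated {w} {D} {τ} (witness inf tr ret (w′ , r , s , t , r<s , s<t , h₁ , h₂ , h₃)) =
      witness inf (Ev-map tracks′ tr) ret
        ((λ q → w′ q ∘ f) , r , s , t , r<s , s<t ,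
         ≈-trans (≈-sym (run-simulated w′ r s)) h₁ ,
         ≈-trans (≈-sym (run-simulated w′ s t)) h₂ ,
         ≈-trans (≈-sym (run-simulated w′ r t)) h₃)
      where
      tracks′ : ∀ t → Tracks A′ w D τ t → Tracks A (λ q → w q ∘ f) D τ t
      tracks′ t h with D t
      ... | true  = ≈-trans h (≈-trans (step≈ _ _) (local A ≈-refl start≈))
      ... | false = ≈-trans h (step≈ _ _)

  witness-cong : ∀ {N} (A : Automaton N) {w w′ D D′ τ τ′ e} →
    Ev (λ t → w t ≈[ width A ] w′ t) → D =* D′ → (∀ i → i < N → τ i =* τ′ i) →
    Witness A w D τ e → Witness A w′ D′ τ′ e
  witness-cong {N} A {w} {w′} {D} {D′} {τ} {τ′} w≈ D≈ τ≈ (witness inf tr ret idem) =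
    witness (IO-map (λ t (D≡ , h) → trans (sym D≡) h) (Ev-IO D≈ inf))
            (Ev-map tracks′ (Ev-× (Ev-× tr (Ev-suc w≈)) (Ev-× D≈ (Ev-× τ≈′ (Ev-suc τ≈′)))))
            (Ev-map (λ t (h , D≡ , τ≡) h′ → ≈-trans (≈-sym τ≡) (h (trans D≡ h′))) (Ev-× ret (Ev-× D≈ τ≈′)))
            idem
    where
    τ≈′ : Ev (λ t → col τ t ≈[ N ] col τ′ t)
    τ≈′ = Ev-< N τ≈

    tracks′ : ∀ t → (Tracks A w D τ t × w (suc t) ≈[ width A ] w′ (suc t)) ×
      D t ≡ D′ t × col τ t ≈[ N ] col τ′ t × col τ (suc t) ≈[ N ] col τ′ (suc t) → Tracks A w′ D′ τ′ t
    tracks′ t ((h , w≡) , D≡ , τ≡ , τ≡′) with D t | D′ t | D≡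
    ... | true  | _ | refl = ≈-trans (≈-sym τ≡′) (≈-trans h (local A w≡ ≈-refl))
    ... | false | _ | refl = ≈-trans (≈-sym τ≡′) (≈-trans h (local A w≡ τ≡))

  -- The letters come from `s` and the witness from `u`, so that richness of a union can be verified
  -- one stage at a time.
  RichIn : (ℕ → Subset) → (ℕ → Subset) → Set
  RichIn s u = ∀ N (A : Automaton N) → Σ ℕ λ d → Σ (ℕ → ℕ) λ κ → Σ State λ e →
    Witness A (col s) (u d) (u ∘ κ) e

  Rich : (ℕ → Subset) → Set
  Rich u = RichIn u u

  reindex : ∀ {N} → Automaton N → (ℕ → ℕ) → Automaton N
  reindex A f with K , f<K ← bounded f (width A) = record
    { width = K ; start = start A ; step = λ a → step A (a ∘ f)
    ; local = λ a≈ r≈ → local A (λ i lt → a≈ (f i) (f<K i lt)) r≈ }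

  -- An automaton reads finitely many rows of `u`, and these all occur in a single `s`.
  rich-directed : ∀ {u} →
    (∀ k → Σ (ℕ → Subset) λ s → (Σ (ℕ → ℕ) λ f → ∀ j → j < k → u j =* s (f j)) × RichIn s u) → Rich u
  rich-directed {u} dir N A with s , (f , u≈) , rich ← dir (width A)
    with d , κ , e , wit ← rich N (reindex A f)
    = d , κ , e , witness-cong A {w = λ t → col s t ∘ f}
        (Ev-map (λ t h i lt → sym (h i lt)) (Ev-< (width A) u≈)) =*-refl (λ _ _ → =*-refl)
        (witness-simulated A (reindex A f) f ≈-refl (λ a r → ≈-refl) wit)

  richIn-⊆ : ∀ {s u} → (∀ i → Σ ℕ λ j → s i =* u j) → Rich s → RichIn s u
  richIn-⊆ {s} {u} sub rich N A with d , κ , e , wit ← rich N A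
    = proj₁ (sub d) , (λ i → proj₁ (sub (κ i))) , e ,
      witness-cong A (0 , λ _ _ → ≈-refl) (proj₂ (sub d)) (λ i _ → proj₂ (sub (κ i))) wit

  coded : ∀ N (k m m₀ : ℕ) → Automaton N
  coded N k m m₀ = record
    { width = k ; start = decode m₀ ; step = table k N m
    ; local = λ a≈ r≈ i _ → cong₂ (λ c c′ → decode m (pair c (pair c′ i))) (code-cong k a≈) (code-cong N r≈) }

  -- Every automaton behaves like one given by a table and a coded start, so countably many automata
  -- suffice.
  coded-complete : ∀ {s u} →
    (∀ N k m m₀ → Σ ℕ λ d → Σ (ℕ → ℕ) λ κ → Σ State λ e → Witness (coded N k m m₀) (col s) (u d) (u ∘ κ) e) →
    RichIn s u
  coded-complete h N A with m , step≈ ← table-complete (width A) N N (step A) (local A)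
    with d , κ , e , wit ← h N (width A) m (code N (start A))
    = d , κ , e , witness-simulated A (coded N (width A) m _) id (decode-code N (start A)) step≈ wit

  -- Closing a family under witnesses

  module RichClosure (s : ℕ → Subset) where

    automaton : ℕ → Σ ℕ Automaton
    automaton c with N , c₁ ← unpair c with k , c₂ ← unpair c₁ with m , m₀ ← unpair c₂ = N , coded N k m m₀

    automaton-code : ∀ N k m m₀ → automaton (pair N (pair k (pair m m₀))) ≡ (N , coded N k m m₀)
    automaton-code N k m m₀
      rewrite unpair-pair N (pair k (pair m m₀)) | unpair-pair k (pair m m₀) | unpair-pair m m₀ = refl

    witnesses : (ℕ → Subset) → ℕ → ℕ → Subset
    witnesses u c zero    = proj₁ (witness-exists (proj₂ (automaton c)) (col u))
    witnesses u c (suc i) = proj₁ (proj₂ (witness-exists (proj₂ (automaton c)) (col u))) i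

    -- Block `0` keeps the family; block `suc c` holds the set and then the record for the automaton
    -- coded by `c`.
    layer : (ℕ → Subset) → ℕ × ℕ → Subset
    layer u (zero  , j) = u j
    layer u (suc c , j) = witnesses u c j

    tower : ℕ → ℕ → Subset
    tower zero    = s
    tower (suc n) = layer (tower n) ∘ unpair

    tower-layer : ∀ n c j → tower (suc n) (pair c j) ≡ layer (tower n) (c , j)
    tower-layer n c j = cong (layer (tower n)) (unpair-pair c j)

    tower-≤ : ∀ {n m} j → n ≤′ m → Σ ℕ λ j′ → tower m j′ ≡ tower n j
    tower-≤ j ≤′-refl = j , refl
    tower-≤ {m = suc m} j (≤′-step n≤m) with j′ , eq ← tower-≤ j n≤m = pair 0 j′ , trans (tower-layer m 0 j′) eq

    closure : ℕ → Subset
    closure j with n , b ← unpair j = tower n b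

    closure-pair : ∀ n j → closure (pair n j) ≡ tower n j
    closure-pair n j rewrite unpair-pair n j = refl

    tower-richIn : ∀ n → RichIn (tower n) closure
    tower-richIn n = coded-complete found
      where
      row : ℕ → ℕ → ℕ
      row c j = pair (suc n) (pair (suc c) j)

      closure-row : ∀ c j → witnesses (tower n) c j =* closure (row c j)
      closure-row c j = =*-reflexive (sym (trans (closure-pair (suc n) _) (tower-layer n (suc c) j)))

      found : ∀ N k m m₀ → Σ ℕ λ d → Σ (ℕ → ℕ) λ κ → Σ State λ e →
        Witness (coded N k m m₀) (col (tower n)) (closure d) (closure ∘ κ) e
      found N k m m₀ = row c 0 , row c ∘ suc , proj₁ wit , witness-cong (coded N k m m₀)
          (0 , λ _ _ → ≈-refl) (closure-row c 0) (λ i _ → closure-row c (suc i)) (proj₂ wit)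
        where
        c : ℕ
        c = pair N (pair k (pair m m₀))

        has : ∀ {NA} → automaton c ≡ NA → Σ State λ e → Witness (proj₂ NA) (col (tower n))
          (witnesses (tower n) c 0) (witnesses (tower n) c ∘ suc) e
        has refl = proj₂ (proj₂ (witness-exists _ (col (tower n))))

        wit : Σ State λ e → Witness (coded N k m m₀) (col (tower n))
          (witnesses (tower n) c 0) (witnesses (tower n) c ∘ suc) e
        wit = has (automaton-code N k m m₀)

    -- Finitely many rows of the union lie in one level of the tower, whose automata are witnessed
    -- one level higher.
    closure-rich : Rich closure
    closure-rich = rich-directed λ k →
      let K , n<K = bounded (proj₁ ∘ unpair) k
      in tower K , choose-below k (λ j lt → row K j (<⇒≤ (n<K j lt))) , tower-richIn K
      where
      row : ∀ K j → proj₁ (unpair j) ≤ K → Σ ℕ λ j′ → closure j =* tower K j′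
      row K j n≤K with j′ , eq ← tower-≤ (proj₂ (unpair j)) (≤⇒≤′ n≤K) = j′ , =*-reflexive (sym eq)

    closure-⊇ : ∀ j → closure (pair 0 j) ≡ s j
    closure-⊇ = closure-pair 0

  opaque
    rich-closure : (s : ℕ → Subset) → Σ (ℕ → Subset) λ u → Rich u × ∀ i → u (pair 0 i) ≡ s i
    rich-closure s = closure , closure-rich , closure-⊇
      where open RichClosure s

  -- Families with the same recurring patterns

  Edge : ℕ → (ℕ → Subset) → State → State → ℕ → Set
  Edge k u p q t = col u t ≈[ k ] p × col u (suc t) ≈[ k ] q

  infix 4 _≼_ _≃_

  -- A pattern recurs exactly when the corresponding meet of rows, complements of rows and their
  -- `σ⁻¹`-images is nonzero in P(ω)/Fin. Thus `u ≃ v` says that passing from `u i` to `v i`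
  -- preserves which of these meets vanish.
  _≼_ _≃_ : (ℕ → Subset) → (ℕ → Subset) → Set
  u ≼ v = ∀ k p q → IO (Edge k u p q) → IO (Edge k v p q)
  u ≃ v = u ≼ v × v ≼ u

  Local : ℕ → (State → State → Set) → Set
  Local k P = ∀ {x x′ y y′} → x ≈[ k ] x′ → y ≈[ k ] y′ → P x y → P x′ y′

  IO-edge : ∀ {A : ℕ → Set} k u → IO A → Σ State λ p → Σ State λ q → IO (λ t → A t × Edge k u p q t)
  IO-edge k u io with p , io₁ ← pigeonhole (col u) k io with q , io₂ ← pigeonhole (col u ∘ suc) k io₁
    = p , q , IO-map (λ t ((a , hp) , hq) → a , hp , hq) io₂

  module _ {k : ℕ} {P : State → State → Set} (local : Local k P) {u v : ℕ → Subset} where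

    -- A local property that recurs does so along one recurring pattern.
    IO-transfer : u ≼ v → IO (λ t → P (col u t) (col u (suc t))) → IO (λ t → P (col v t) (col v (suc t)))
    IO-transfer u≼v io with p , q , io₁ ← IO-edge k u io with _ , _ , h , hp , hq ← io₁ 0
      = IO-map (λ t (hp′ , hq′) → local (≈-sym hp′) (≈-sym hq′) (local hp hq h))
               (u≼v k p q (IO-map (λ _ → proj₂) io₁))

  -- The direction is reversed: a failure recurring in `v` would recur in `u`.
  Ev-transfer : ∀ {k P} → Local k P → ∀ {u v} → v ≼ u →
    Ev (λ t → P (col u t) (col u (suc t))) → Ev (λ t → P (col v t) (col v (suc t)))
  Ev-transfer {k} {P} local v≼u ev = by-contradiction λ ¬ev →
    let _ , _ , p , ¬p = Ev-IO ev (IO-transfer ¬local v≼u (¬Ev→IO¬ ¬ev)) 0 in ¬p p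
    where
    ¬local : Local k (λ x y → ¬ P x y)
    ¬local hx hy ¬p p = ¬p (local (≈-sym hx) (≈-sym hy) p)

  ≼-directed : ∀ {u v} → (∀ k → Σ (ℕ → Subset) λ s → Σ (ℕ → Subset) λ s′ → s ≼ s′ ×
    Σ (ℕ → ℕ) λ f → ∀ j → j < k → u j =* s (f j) × v j =* s′ (f j)) → u ≼ v
  ≼-directed {u} {v} dir k p q io with s , s′ , s≼s′ , f , h ← dir k with K , f<K ← bounded f k
    = IO-map (λ t ((h₀ , h₁) , hp , hq) → ≈-trans h₀ hp , ≈-trans h₁ hq) (Ev-IO (Ev-× v≈ (Ev-suc v≈))
        (IO-transfer {K} {λ x y → x ∘ f ≈[ k ] p × y ∘ f ≈[ k ] q} (λ x≈ y≈ (hp , hq) → ≈-trans (≈-sym (λ i lt → x≈ (f i) (f<K i lt))) hp ,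
                                              ≈-trans (≈-sym (λ i lt → y≈ (f i) (f<K i lt))) hq) s≼s′
          (IO-map (λ t ((h₀ , h₁) , hp , hq) → ≈-trans (≈-sym h₀) hp , ≈-trans (≈-sym h₁) hq)
            (Ev-IO (Ev-× u≈ (Ev-suc u≈)) io))))
    where
    u≈ : Ev (λ t → col u t ≈[ k ] (col s t ∘ f))
    u≈ = Ev-< k λ j lt → proj₁ (h j lt)

    v≈ : Ev (λ t → col v t ≈[ k ] (col s′ t ∘ f))
    v≈ = Ev-< k λ j lt → proj₂ (h j lt)

  module _ {N : ℕ} (A : Automaton N) {c c′ : ℕ → Subset} (c≃c′ : c ≃ c′) {d : ℕ} {κ : ℕ → ℕ} {e : State} where

    -- Infinity of the set, tracking and returning are recurrent or eventual local conditions on the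
    -- rows, so they transfer; idempotence does not mention the family.
    witness-≃ : Witness A (col c) (c d) (c ∘ κ) e → Witness A (col c′) (c′ d) (c′ ∘ κ) e
    witness-≃ (witness inf tr ret idem) with K , κ<K ← bounded κ N = witness
      (IO-transfer {suc d} (λ x≈ _ → trans (sym (x≈ d ≤-refl))) (proj₁ c≃c′) inf)
      (Ev-transfer {K ⊔ℕ (suc d ⊔ℕ width A)} {λ x y → y ∘ κ ≈[ N ] step A y (if x d then start A else x ∘ κ)}
        (λ x≈ y≈ → tracks-local κ<K (≈-≤ (m≤m⊔n K _) x≈) (≈-≤ (m≤m⊔n K _) y≈)
          (≈-≤ (≤-trans (m≤n⊔m (suc d) _) (m≤n⊔m K _)) y≈)
          (x≈ d (≤-trans (m≤m⊔n (suc d) (width A)) (m≤n⊔m K _)))) (proj₂ c≃c′) tr)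
      (Ev-transfer {K ⊔ℕ suc d} {λ x y → x d ≡ true → x ∘ κ ≈[ N ] e}
        (λ x≈ _ h d∈ → ≈-trans (≈-sym (λ i lt → x≈ (κ i) (≤-trans (κ<K i lt) (m≤m⊔n K _))))
                               (h (trans (x≈ d (m≤n⊔m K _)) d∈))) (proj₂ c≃c′) ret)
      idem
      where
      tracks-local : ∀ {K} → (∀ i → i < N → κ i < K) → ∀ {x x′ y y′ : State} →
        x ≈[ K ] x′ → y ≈[ K ] y′ → y ≈[ width A ] y′ → x d ≡ x′ d →
        y ∘ κ ≈[ N ] step A y (if x d then start A else x ∘ κ) →
        y′ ∘ κ ≈[ N ] step A y′ (if x′ d then start A else x′ ∘ κ)
      tracks-local κ<K {x} {x′} x≈ y≈ y≈′ d≡ h with x d | x′ d | d≡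
      ... | true  | _ | refl = ≈-trans (λ i lt → sym (y≈ (κ i) (κ<K i lt))) (≈-trans h (local A y≈′ ≈-refl))
      ... | false | _ | refl = ≈-trans (λ i lt → sym (y≈ (κ i) (κ<K i lt)))
                                       (≈-trans h (local A y≈′ λ i lt → x≈ (κ i) (κ<K i lt)))

  rich-≃ : ∀ {c c′} → c ≃ c′ → Rich c → Rich c′
  rich-≃ c≃c′ rich N A with d , κ , e , wit ← rich N A = d , κ , e , witness-≃ A c≃c′ wit

  -- Paths as an automaton

  splice : (ℕ → State) → ℕ → (ℕ → State) → ℕ → State
  splice y t z r with r ≤? t
  ... | yes _ = y r
  ... | no _  = z r

  splice-≤ : ∀ {y t z r} → r ≤ t → splice y t z r ≡ y r
  splice-≤ {t = t} {r = r} r≤t with r ≤? t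
  ... | yes _  = refl
  ... | no r≰t = contradiction r≤t r≰t

  splice-> : ∀ {y t z r} → t < r → splice y t z r ≡ z r
  splice-> {t = t} {r = r} t<r with r ≤? t
  ... | yes r≤t = contradiction t<r (≤⇒≯ r≤t)
  ... | no _    = refl

  splice-≥ : ∀ {k y t z r} → y t ≈[ k ] z t → t ≤ r → splice y t z r ≈[ k ] z r
  splice-≥ {t = t} {r = r} seam t≤r i lt with r ≤? t
  ... | no _    = refl
  ... | yes r≤t with refl ← ≤-antisym t≤r r≤t = seam i lt

  -- Paths through a graph on states modulo ≈[ ℓ ] whose edges depend on the letter read.
  module Paths (ℓ : ℕ) (Good : State → State → State → Set) (Hit : Bool → State → State → Set)
    (good-local : ∀ {a a′ x x′ y y′ : State} → a ≈[ ℓ ] a′ → x ≈[ ℓ ] x′ → y ≈[ ℓ ] y′ → Good a x y → Good a′ x′ y′)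
    (hit-local : ∀ b → Local ℓ (Hit b)) where

    GoodOn : (ℕ → State) → (ℕ → State) → ℕ → ℕ → Set
    GoodOn w y s t = ∀ r → s ≤ r → r < t → Good (w (suc r)) (y r) (y (suc r))

    -- In `Extension` the two targets are a synchronising edge (`false`) and a scheduled pattern
    -- (`true`).
    Visits : (ℕ → State) → ℕ → ℕ → Maybe Bool → Set
    Visits y s t nothing  = ⊤
    Visits y s t (just b) = Σ ℕ λ r → s ≤ r × r < t × Hit b (y r) (y (suc r))

    record Path (w : ℕ → State) (s t : ℕ) (p q : State) (v : Maybe Bool) : Set where
      constructor path
      field
        trace  : ℕ → State
        source : trace s ≈[ ℓ ] p
        target : trace t ≈[ ℓ ] q
        good   : GoodOn w trace s t
        visits : Visits trace s t v

    visits-mono : ∀ v {y s t s′ t′} → s′ ≤ s → t ≤ t′ → Visits y s t v → Visits y s′ t′ v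
    visits-mono nothing  _  _  _ = tt
    visits-mono (just b) s≤ t≤ (r , s≤r , r<t , h) = r , ≤-trans s≤ s≤r , ≤-trans r<t t≤ , h

    visits-local : ∀ v {y z s t} → (∀ r → s ≤ r → r ≤ t → y r ≈[ ℓ ] z r) → Visits y s t v → Visits z s t v
    visits-local nothing  _ _ = tt
    visits-local (just b) h (r , s≤r , r<t , hit) =
      r , s≤r , r<t , hit-local b (h r s≤r (<⇒≤ r<t)) (h (suc r) (m≤n⇒m≤1+n s≤r) r<t) hit

    -- A path certifies at most one visit, so the concatenation is given twice, once with the visit
    -- of each piece.
    join : ∀ {w s t u p q r v v′} → s ≤ t → t ≤ u → Path w s t p q v → Path w t u q r v′ →
      Path w s u p r v × Path w s u p r v′
    join {w} {s} {t} {u} {p} {q} {r} {v} {v′} s≤t t≤u (path y yp yq y-good y-visits) (path z zq zr z-good z-visits) =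
      path x xp xr x-good (visits-mono v ≤-refl t≤u
        (visits-local v (λ i _ i≤t j lt → cong (λ f → f j) (sym (splice-≤ {y} {t} {z} i≤t))) y-visits)) ,
      path x xp xr x-good (visits-mono v′ s≤t ≤-refl
        (visits-local v′ (λ i t≤i _ → ≈-sym (splice-≥ seam t≤i)) z-visits))
      where
      x : ℕ → State
      x = splice y t z

      seam : y t ≈[ ℓ ] z t
      seam = ≈-trans yq (≈-sym zq)

      xp : x s ≈[ ℓ ] p
      xp rewrite splice-≤ {y} {t} {z} s≤t = yp

      xr : x u ≈[ ℓ ] r
      xr = ≈-trans (splice-≥ seam t≤u) zr

      x-good : GoodOn w x s u
      x-good i s≤i i<u with ≤-<-connex t i
      ... | inj₁ t≤i = good-local ≈-refl (≈-sym (splice-≥ seam t≤i)) (≈-sym (splice-≥ seam (m≤n⇒m≤1+n t≤i)))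
                                  (z-good i t≤i i<u)
      ... | inj₂ i<t rewrite splice-≤ {y} {t} {z} (<⇒≤ i<t) | splice-≤ {y} {t} {z} i<t = y-good i s≤i i<t

    split : ∀ {w s t u p r} v → s ≤ t → t ≤ u → Path w s u p r v → Σ State λ q →
      (Path w s t p q v × Path w t u q r nothing) ⊎ (Path w s t p q nothing × Path w t u q r v)
    split {w} {s} {t} {u} {p} {r} v s≤t t≤u (path y yp yr good visits) = y t , at v visits
      where
      left : ∀ {v} → Visits y s t v → Path w s t p (y t) v
      left h = path y yp ≈-refl (λ i s≤i i<t → good i s≤i (≤-trans i<t t≤u)) h

      right : ∀ {v} → Visits y t u v → Path w t u (y t) r v
      right h = path y ≈-refl yr (λ i t≤i i<u → good i (≤-trans s≤t t≤i) i<u) h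

      at : ∀ v → Visits y s u v →
        (Path w s t p (y t) v × Path w t u (y t) r nothing) ⊎ (Path w s t p (y t) nothing × Path w t u (y t) r v)
      at nothing  _ = inj₁ (left tt , right tt)
      at (just b) (i , s≤i , i<u , hit) with ≤-<-connex t i
      ... | inj₁ t≤i = inj₂ (left tt , right (i , t≤i , i<u , hit))
      ... | inj₂ i<t = inj₁ (left (i , s≤i , i<t , hit) , right tt)

    path-cong : ∀ {w s t p p′ q q′ v} → p ≈[ ℓ ] p′ → q ≈[ ℓ ] q′ → Path w s t p q v → Path w s t p′ q′ v
    path-cong p≈ q≈ (path y yp yq good visits) = path y (≈-trans yp p≈) (≈-trans yq q≈) good visits

    edge : ∀ {w t q q′} → Good (w (suc t)) q q′ → ∀ v → (∀ b → v ≡ just b → Hit b q q′) →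
      Path w t (suc t) q q′ v
    edge {w} {t} {q} {q′} good v hit = path y (≡⇒≈ y₀) (≡⇒≈ y₁)
        (λ r t≤r r<st → at r (≤-antisym (≤-pred r<st) t≤r)) (visits v hit)
      where
      y : ℕ → State
      y = splice (λ _ → q) t (λ _ → q′)

      y₀ : y t ≡ q
      y₀ = splice-≤ {λ _ → q} {t} {λ _ → q′} ≤-refl

      y₁ : y (suc t) ≡ q′
      y₁ = splice-> {λ _ → q} {t} {λ _ → q′} ≤-refl

      ≡⇒≈ : ∀ {x x′ : State} → x ≡ x′ → x ≈[ ℓ ] x′
      ≡⇒≈ refl = ≈-refl

      at : ∀ r → r ≡ t → Good (w (suc r)) (y r) (y (suc r))
      at r refl = subst₂ (Good (w (suc t))) (sym y₀) (sym y₁) good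

      visits : ∀ v → (∀ b → v ≡ just b → Hit b q q′) → Visits y t (suc t) v
      visits nothing  _   = tt
      visits (just b) hit = t , ≤-refl , ≤-refl , subst₂ (Hit b) (sym y₀) (sym y₁) (hit b refl)

    visitCode : Maybe Bool → ℕ
    visitCode nothing  = 0
    visitCode (just b) = suc (bit b)

    visitCode<3 : ∀ v → visitCode v < 3
    visitCode<3 nothing      = s≤s z≤n
    visitCode<3 (just false) = s≤s (s≤s z≤n)
    visitCode<3 (just true)  = s≤s (s≤s (s≤s z≤n))

    visitCode-injective : ∀ {v v′} → visitCode v ≡ visitCode v′ → v ≡ v′
    visitCode-injective {nothing} {nothing} _  = refl
    visitCode-injective {just _}  {just _}  eq = cong just (bit-injective (suc-injective eq))

    index : State → State → Maybe Bool → ℕ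
    index p q v = pair (code ℓ p) (pair (code ℓ q) (visitCode v))

    index-cong : ∀ {p p′ q q′ v} → p ≈[ ℓ ] p′ → q ≈[ ℓ ] q′ → index p q v ≡ index p′ q′ v
    index-cong p≈ q≈ = cong₂ (λ a b → pair a (pair b _)) (code-cong ℓ p≈) (code-cong ℓ q≈)

    index-injective : ∀ p q v p′ q′ v′ → index p q v ≡ index p′ q′ v′ → p ≈[ ℓ ] p′ × q ≈[ ℓ ] q′ × v ≡ v′
    index-injective p q v p′ q′ v′ eq
      with p≡ , eq′ ← pair-injective (code ℓ p) _ (code ℓ p′) _ eq
      with q≡ , v≡ ← pair-injective (code ℓ q) _ (code ℓ q′) _ eq′
      = code-injective ℓ p≡ , code-injective ℓ q≡ , visitCode-injective v≡

    index-bounded : Σ ℕ λ N → ∀ p q v → index p q v < N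
    index-bounded with K , code<K ← code-bounded ℓ with L , h ← pair-bounded K 3 with N , h′ ← pair-bounded K L
      = N , λ p q v → h′ _ _ (code<K p) (h _ _ (code<K q) (visitCode<3 v))

    N : ℕ
    N = proj₁ index-bounded

    index<N : ∀ p q v → index p q v < N
    index<N = proj₂ index-bounded

    -- The visit is either inherited from the shorter path or made by the new edge; in the second
    -- case the shorter path is recorded with `nothing`.
    record Extends (a r : State) (i : ℕ) : Set where
      constructor extends
      field
        {p q q′} : State
        {v v₀}   : Maybe Bool
        is-index : i ≡ index p q′ v
        good     : Good a q q′
        before   : r (index p q v₀) ≡ true
        visit    : v₀ ≡ v ⊎ (v₀ ≡ nothing × ∀ b → v ≡ just b → Hit b q q′)

    IsStart : ℕ → Set
    IsStart i = Σ State λ p → i ≡ index p p nothing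

    -- Its state after reading the letters in (s , t] lists the triples (p , q , v) with a path from p to q visiting v.
    automaton : Automaton N
    automaton = record
      { width = ℓ ; start = λ i → char (IsStart i) ; step = λ a r i → char (Extends a r i)
      ; local = λ a≈ r≈ i _ → Bool-ext (λ h → char-in (move a≈ r≈ (char-out h)))
                                       (λ h → char-in (move (≈-sym a≈) (≈-sym r≈) (char-out h))) }
      where
      move : ∀ {a a′ r r′ i} → a ≈[ ℓ ] a′ → r ≈[ N ] r′ → Extends a r i → Extends a′ r′ i
      move a≈ r≈ (extends eq good before visit) =
        extends eq (good-local a≈ ≈-refl ≈-refl good) (trans (sym (r≈ _ (index<N _ _ _))) before) visit

    Recorded : State → State → State → Maybe Bool → Set
    Recorded e p q v = e (index p q v) ≡ true

    run→path : ∀ w {s t} → s ≤′ t → ∀ p q v → Recorded (run automaton w s t) p q v → Path w s t p q v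
    run→path w {s} ≤′-refl p q v h with p′ , eq ← char-out (subst (λ x → x (index p q v) ≡ true) (run-start automaton w s) h)
      with p≈ , q≈ , refl ← index-injective p q v p′ p′ nothing eq
      = path (λ _ → p) ≈-refl (≈-trans p≈ (≈-sym q≈)) (λ r s≤r r<s → contradiction s≤r (<⇒≱ r<s)) tt
    run→path w {s} {suc t} (≤′-step s≤t) p q v h
      with extends {p₀} {q₀} {q₁} {v₁} {v₀} eq good before visit
        ← char-out (subst (λ x → x (index p q v) ≡ true) (run-suc automaton w (≤′⇒≤ s≤t)) h)
      with p≈ , q≈ , refl ← index-injective p q v p₀ q₁ v₁ eq
      = path-cong (≈-sym p≈) (≈-sym q≈) (add visit (run→path w s≤t p₀ q₀ v₀ before))
      where
      add : ∀ {v₀} → v₀ ≡ v ⊎ (v₀ ≡ nothing × ∀ b → v ≡ just b → Hit b q₀ q₁) →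
        Path w s t p₀ q₀ v₀ → Path w s (suc t) p₀ q₁ v
      add (inj₁ refl)        π = proj₁ (join (≤′⇒≤ s≤t) (n≤1+n t) π (edge good nothing λ _ ()))
      add (inj₂ (refl , hit)) π = proj₂ (join (≤′⇒≤ s≤t) (n≤1+n t) π (edge good v hit))

    path→run : ∀ w {s t} → s ≤′ t → ∀ p q v → Path w s t p q v → Recorded (run automaton w s t) p q v
    path→run w {s} ≤′-refl p q nothing (path y yp yq _ _) =
      subst (λ x → x (index p q nothing) ≡ true) (sym (run-start automaton w s))
        (char-in (p , index-cong ≈-refl (≈-trans (≈-sym yq) yp)))
    path→run w ≤′-refl p q (just b) (path _ _ _ _ (r , s≤r , r<s , _)) = contradiction s≤r (<⇒≱ r<s)
    path→run w {s} {suc t} (≤′-step s≤t) p q v (path y yp yq good visits) =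
      subst (λ x → x (index p q v) ≡ true) (sym (run-suc automaton w (≤′⇒≤ s≤t))) (char-in (last v visits))
      where
      to : ∀ {v₀} → Visits y s t v₀ → Path w s t p (y t) v₀
      to h = path y yp ≈-refl (λ r s≤r r<t → good r s≤r (m≤n⇒m≤1+n r<t)) h

      last-good : Good (w (suc t)) (y t) q
      last-good = good-local ≈-refl ≈-refl yq (good t (≤′⇒≤ s≤t) ≤-refl)

      last : ∀ v → Visits y s (suc t) v → Extends (w (suc t)) (run automaton w s t) (index p q v)
      last nothing _ = extends refl last-good (path→run w s≤t p (y t) nothing (to tt)) (inj₁ refl)
      last (just b) (r , s≤r , r<st , hit) with m<1+n⇒m<n∨m≡n r<st
      ... | inj₁ r<t  = extends refl last-good (path→run w s≤t p (y t) (just b) (to (r , s≤r , r<t , hit))) (inj₁ refl)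
      ... | inj₂ refl = extends refl last-good (path→run w s≤t p (y t) nothing (to tt))
                          (inj₂ (refl , λ { _ refl → hit-local b ≈-refl yq hit }))

    Agrees : State → (ℕ → State) → ℕ → ℕ → Set
    Agrees e w s t = ∀ p q v → (Recorded e p q v → Path w s t p q v) × (Path w s t p q v → Recorded e p q v)

    run≈→agrees : ∀ {e w s t} → s ≤ t → run automaton w s t ≈[ N ] e → Agrees e w s t
    run≈→agrees s≤t run≈ p q v =
      (λ h → run→path _ (≤⇒≤′ s≤t) p q v (trans (run≈ _ (index<N p q v)) h)) ,
      (λ π → trans (sym (run≈ _ (index<N p q v))) (path→run _ (≤⇒≤′ s≤t) p q v π))

    -- A path over the whole interval splits in the middle. Each half can be exchanged for one over
    -- the sample word of the idempotence, since `e` describes both, and the halves are joined again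
    -- there; the whole sample is also described by `e`. The converse is symmetric.
    agrees-trans : ∀ {e w s t u} → Idempotent automaton e → s ≤ t → t ≤ u →
      Agrees e w s t → Agrees e w t u → Agrees e w s u
    agrees-trans {e} {w} {s} {t} {u} (w₀ , r₀ , s₀ , t₀ , r<s , s<t , run₁ , run₂ , run₃) s≤t t≤u ag₁ ag₂ p r v =
      (λ h → relay s≤t t≤u ag₁ ag₂ ag₁₀ ag₂₀ (split v (<⇒≤ r<s) (<⇒≤ s<t) (proj₁ (ag₀ p r v) h))) ,
      (λ π → proj₂ (ag₀ p r v) (relay (<⇒≤ r<s) (<⇒≤ s<t) ag₁₀ ag₂₀ ag₁ ag₂ (split v s≤t t≤u π)))
      where
      ag₁₀ : Agrees e w₀ r₀ s₀
      ag₁₀ = run≈→agrees (<⇒≤ r<s) run₁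

      ag₂₀ : Agrees e w₀ s₀ t₀
      ag₂₀ = run≈→agrees (<⇒≤ s<t) run₂

      ag₀ : Agrees e w₀ r₀ t₀
      ag₀ = run≈→agrees (<⇒≤ (<-trans r<s s<t)) run₃

      relay : ∀ {w w′ a b c a′ b′ c′} → a ≤ b → b ≤ c → Agrees e w a b → Agrees e w b c →
        Agrees e w′ a′ b′ → Agrees e w′ b′ c′ →
        (Σ State λ q → (Path w′ a′ b′ p q v × Path w′ b′ c′ q r nothing) ⊎
                       (Path w′ a′ b′ p q nothing × Path w′ b′ c′ q r v)) → Path w a c p r v
      relay a≤b b≤c g h g′ h′ (q , inj₁ (π , ρ)) = proj₁ (join a≤b b≤c
        (proj₁ (g p q v) (proj₂ (g′ p q v) π)) (proj₁ (h q r nothing) (proj₂ (h′ q r nothing) ρ)))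
      relay a≤b b≤c g h g′ h′ (q , inj₂ (π , ρ)) = proj₂ (join a≤b b≤c
        (proj₁ (g p q nothing) (proj₂ (g′ p q nothing) π)) (proj₁ (h q r v) (proj₂ (h′ q r v) ρ)))

    -- Consecutive times agree with `e` by the record of runs; idempotence extends this to arbitrary
    -- pairs.
    witness→agrees : ∀ {w D τ e} → Witness automaton w D τ e →
      Ev (λ s → ∀ t → D s ≡ true → D t ≡ true → s < t → Agrees e w s t)
    witness→agrees {w} {D} {τ} {e} (witness _ (M₁ , tr) (M₂ , ret) idem) =
      M₁ ⊔ℕ M₂ , λ s le t → all le t t ≤-refl
      where
      consecutive : ∀ {s t} → M₁ ⊔ℕ M₂ ≤ s → D s ≡ true → D t ≡ true → s < t → gap D s t → Agrees e w s t
      consecutive {s} {t} le s∈D t∈D s<t g = run≈→agrees (<⇒≤ s<t)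
        (≈-trans (≈-sym (run-tracked automaton w D τ tr t (≤-trans (m≤m⊔n M₁ M₂) le) s∈D s<t g))
                 (ret t (≤-trans (m≤n⊔m M₁ M₂) (≤-trans le (<⇒≤ s<t))) t∈D))

      -- The recursion descends on the bound `n` for `t`.
      all : ∀ {s} → M₁ ⊔ℕ M₂ ≤ s → ∀ n t → t ≤ n → D s ≡ true → D t ≡ true → s < t → Agrees e w s t
      all le n t t≤n s∈D t∈D s<t with previous D t s∈D s<t
      ... | r , s≤r , r<t , r∈D , g with m≤n⇒m<n∨m≡n s≤r | consecutive (≤-trans le s≤r) r∈D t∈D r<t g
      ...   | inj₂ refl | ag = ag
      all le zero    .zero z≤n s∈D t∈D () | _ | inj₁ _ | _
      all le (suc n) t t≤n s∈D t∈D s<t | r , s≤r , r<t , r∈D , g | inj₁ s<r | ag =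
        agrees-trans idem s≤r (<⇒≤ r<t) (all le n r (≤-pred (≤-trans r<t t≤n)) s∈D r∈D s<r) ag

  -- Extending a partial isomorphism

  module Extension (u : ℕ → Subset) (ρ : ℕ → ℕ) (c′ : ℕ → Subset)
    (c≃c′ : u ∘ ρ ≃ c′) (rich : Rich (u ∘ ρ)) where

    c : ℕ → Subset
    c = u ∘ ρ

    Recurs : ℕ → State → State → Set
    Recurs ℓ x y = IO (Edge ℓ u x y)

    -- The edges are the recurring patterns of `u`; the letter `a` prescribes those rows of the
    -- target that lie in the image of `ρ`, as far as both indices are below `ℓ`.
    Good : ℕ → State → State → State → Set
    Good ℓ a x y = Recurs ℓ x y × ∀ i → i < ℓ → ρ i < ℓ → y (ρ i) ≡ a i

    recurs-mono : ∀ {k ℓ x y} → k ≤ ℓ → Recurs ℓ x y → Recurs k x y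
    recurs-mono k≤ℓ = IO-map λ t (hx , hy) → ≈-≤ k≤ℓ hx , ≈-≤ k≤ℓ hy

    recurs-local : ∀ ℓ → Local ℓ (Recurs ℓ)
    recurs-local ℓ x≈ y≈ = IO-map λ t (hx , hy) → ≈-trans hx x≈ , ≈-trans hy y≈

    good-mono : ∀ {k ℓ a x y} → k ≤ ℓ → Good ℓ a x y → Good k a x y
    good-mono k≤ℓ (rec , h) = recurs-mono k≤ℓ rec , λ i i<k ρi<k → h i (≤-trans i<k k≤ℓ) (≤-trans ρi<k k≤ℓ)

    good-local : ∀ ℓ {a a′ x x′ y y′} → a ≈[ ℓ ] a′ → x ≈[ ℓ ] x′ → y ≈[ ℓ ] y′ → Good ℓ a x y → Good ℓ a′ x′ y′
    good-local ℓ a≈ x≈ y≈ (rec , h) = recurs-local ℓ x≈ y≈ rec ,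
      λ i i<ℓ ρi<ℓ → trans (sym (y≈ (ρ i) ρi<ℓ)) (trans (h i i<ℓ ρi<ℓ) (a≈ i i<ℓ))

    -- Otherwise the pigeonhole principle would make one of the non-recurring patterns recur.
    Ev-recurs : ∀ ℓ → Ev (λ t → Recurs ℓ (col u t) (col u (suc t)))
    Ev-recurs ℓ = by-contradiction λ ¬ev → absurd (IO-edge ℓ u (¬Ev→IO¬ ¬ev))
      where
      absurd : ¬ (Σ State λ p → Σ State λ q → IO (λ t → ¬ Recurs ℓ (col u t) (col u (suc t)) × Edge ℓ u p q t))
      absurd (p , q , io) with _ , _ , ¬rec , hp , hq ← io 0 =
        ¬rec (recurs-local ℓ (≈-sym hp) (≈-sym hq) (IO-map (λ _ → proj₂) io))

    Occurs : (Bool → State → State → Set) → Maybe Bool → Set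
    Occurs Hit nothing  = ⊤
    Occurs Hit (just b) = IO (λ t → Hit b (col u t) (col u (suc t)))

    module Loops (ℓ : ℕ) (Hit : Bool → State → State → Set) (hit-local : ∀ b → Local ℓ (Hit b)) where

      open Paths ℓ (Good ℓ) Hit (good-local ℓ) hit-local public

      record Loop : Set where
        field
          d        : ℕ
          p        : State
          infinite : Inf (c′ d)
          returns  : IO (λ t → c d t ≡ true × col u t ≈[ ℓ ] p)
          loops    : Ev (λ s → ∀ t → c′ d s ≡ true → c′ d t ≡ true → s < t →
                       ∀ v → Occurs Hit v → Path (col c′) s t p p v)

      opaque
        -- Over `c` the columns of `u` themselves form a path from one return to `p` to a later one,
        -- past any recurring target. Hence `e` records such a loop, and `e` describes the paths
        -- over `c′` as well.
        loop : Loop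
        loop with d , κ , e , wit ← rich N automaton
          with p , returns ← pigeonhole (col u) ℓ (Witness.infinite wit)
          = record
            { d = d ; p = p ; infinite = Witness.infinite wit′ ; returns = returns
            ; loops = Ev-map (λ s ag t s∈ t∈ s<t v occ → proj₁ (ag t s∈ t∈ s<t p p v)
                               (recorded {e = e} (Ev-× (Ev-recurs ℓ) (witness→agrees wit)) returns v occ))
                             (witness→agrees wit′) }
          where
          wit′ : Witness automaton (col c′) (c′ d) (c′ ∘ κ) e
          wit′ = witness-≃ automaton c≃c′ wit

          recorded : ∀ {d p e} →
            Ev (λ s → Recurs ℓ (col u s) (col u (suc s)) ×
                      ∀ t → c d s ≡ true → c d t ≡ true → s < t → Agrees e (col c) s t) →
            IO (λ t → c d t ≡ true × col u t ≈[ ℓ ] p) → ∀ v → Occurs Hit v → Recorded e p p v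
          recorded {d} {p} {e} (M , h) returns v occ with s , M≤s , s∈ , s≈p ← returns M = record-at v occ
            where
            walk : ∀ t → s < t → c d t ≡ true → col u t ≈[ ℓ ] p → ∀ v → Visits (col u) s t v → Recorded e p p v
            walk t s<t t∈ t≈p v visits = proj₂ (proj₂ (h s M≤s) t s∈ t∈ s<t p p v)
              (path (col u) s≈p t≈p
                (λ r s≤r _ → proj₁ (h r (≤-trans M≤s s≤r)) , λ _ _ _ → refl) visits)

            record-at : ∀ v → Occurs Hit v → Recorded e p p v
            record-at nothing _ with t , s<t , t∈ , t≈p ← returns (suc s) = walk t s<t t∈ t≈p nothing tt
            record-at (just b) occ with r , s≤r , hit ← occ s with t , r<t , t∈ , t≈p ← returns (suc r) =
              walk t (≤-trans (s≤s s≤r) r<t) t∈ t≈p (just b) (r , s≤r , r<t , hit)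

    -- Stages of the construction

    record Node : Set where
      field
        level : ℕ
        d     : ℕ
        p     : State

    open Node

    -- Every triple is `task n` for arbitrarily large `n`, one for each first component of the code,
    -- so each pattern is scheduled again and again.
    task : ℕ → ℕ × ℕ × ℕ
    task n with k , pq ← unpair (proj₂ (unpair n)) = k , unpair pq

    taskLevel : ℕ → ℕ
    taskLevel n = proj₁ (task n)

    Meets : ℕ × ℕ × ℕ → State → State → Set
    Meets (k , m , m′) x y = x ≈[ k ] decode m × y ≈[ k ] decode m′

    -- The level must make `Target n ν` local and must grow with `n`; the two `suc` terms put the
    -- rows `ρ (d ν)` and `d ν` strictly below it, so that good paths respect the previous return
    -- set.
    nextLevel : ℕ → Node → ℕ
    nextLevel n ν = level ν + (suc (ρ (d ν)) + (suc (d ν) + (taskLevel n + n)))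

    -- Meeting the previous node at one of its return times is what lets consecutive paths be spliced.
    Target : ℕ → Node → Bool → State → State → Set
    Target n ν false x y = y (ρ (d ν)) ≡ true × y ≈[ level ν ] p ν
    Target n ν true  x y = Meets (task n) x y

    taskLevel≤ : ∀ n ν → taskLevel n ≤ nextLevel n ν
    taskLevel≤ n ν = m≤n⇒m≤o+n (level ν) (m≤n⇒m≤o+n (suc (ρ (d ν)))
      (m≤n⇒m≤o+n (suc (d ν)) (m≤m+n (taskLevel n) n)))

    n≤nextLevel : ∀ n ν → n ≤ nextLevel n ν
    n≤nextLevel n ν = m≤n⇒m≤o+n (level ν) (m≤n⇒m≤o+n (suc (ρ (d ν)))
      (m≤n⇒m≤o+n (suc (d ν)) (m≤n+m n (taskLevel n))))

    ρd<nextLevel : ∀ n ν → ρ (d ν) < nextLevel n ν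
    ρd<nextLevel n ν = m≤n⇒m≤o+n (level ν) (m≤m+n (suc (ρ (d ν))) _)

    d<nextLevel : ∀ n ν → d ν < nextLevel n ν
    d<nextLevel n ν = m≤n⇒m≤o+n (level ν) (m≤n⇒m≤o+n (suc (ρ (d ν))) (m≤m+n (suc (d ν)) _))

    level≤nextLevel : ∀ n ν → level ν ≤ nextLevel n ν
    level≤nextLevel n ν = m≤m+n (level ν) _

    target-local : ∀ n ν b → Local (nextLevel n ν) (Target n ν b)
    target-local n ν false x≈ y≈ (y∈ , y≈p) =
      trans (sym (y≈ _ (ρd<nextLevel n ν))) y∈ , ≈-trans (≈-≤ (level≤nextLevel n ν) (≈-sym y≈)) y≈p
    target-local n ν true x≈ y≈ (hx , hy) =
      ≈-trans (≈-≤ (taskLevel≤ n ν) (≈-sym x≈)) hx , ≈-trans (≈-≤ (taskLevel≤ n ν) (≈-sym y≈)) hy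

    module Stage (n : ℕ) (ν : Node) where

      open Loops (nextLevel n ν) (Target n ν) (target-local n ν) public
      open Loop loop public renaming (d to d⁺; p to p⁺)

      next : Node
      next = record { level = nextLevel n ν ; d = d⁺ ; p = p⁺ }

    node : ℕ → Node
    -- A placeholder: synchronisation is only requested with nodes from `node 1` on.
    node zero    = record { level = 0 ; d = 0 ; p = λ _ → false }
    node (suc n) = Stage.next n (node n)

    module S (n : ℕ) = Stage n (node n)

    ℓ : ℕ → ℕ
    ℓ n = level (node (suc n))

    opaque
      -- The scheduled pattern is demanded only if it recurs in `u`.
      goal : ∀ n → Σ (Maybe Bool) λ v → Occurs (Target n (node n)) v ×
        (Occurs (Target n (node n)) (just true) → v ≡ just true)
      goal n with em (Occurs (Target n (node n)) (just true))
      ... | yes occ = just true , occ , λ _ → refl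
      ... | no ¬occ = nothing , tt , λ occ → contradiction occ ¬occ

    record Time (n : ℕ) : Set where
      field
        time  : ℕ
        late  : proj₁ (S.loops n) ≤ time
        time∈ : c′ (S.d⁺ n) time ≡ true

    open Time

    record Segment (n : ℕ) (t : Time n) : Set where
      field
        end   : Time (suc n)
        later : time t < time end
        route : S.Path n (col c′) (time t) (time end) (S.p⁺ n) (S.p⁺ (suc n)) (proj₁ (goal n))

    opaque
      -- A loop of stage `suc n` from `s` to `e` meets `S.p⁺ n` at a time in the return set of stage
      -- `n`. A loop of stage `n` that attains the goal leads to that time, and the rest of the
      -- higher loop leads on to `e`.
      segment : ∀ n t → Segment n t
      segment n t
        with s , le , s∈ ← S.infinite (suc n) (suc (time t) + proj₁ (S.loops (suc n)))
        with e , s<e , e∈ ← S.infinite (suc n) (suc s)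
        = through (proj₂ (S.loops (suc n)) s (≤-trans (m≤n+m _ (suc (time t))) le) e s∈ e∈ s<e (just false) sync)
        where
        sync : Occurs (Target (suc n) (node (suc n))) (just false)
        -- The target tests the second column of an edge, hence the shift by one.
        sync = IO-suc (S.returns n)

        through : S.Path (suc n) (col c′) s e (S.p⁺ (suc n)) (S.p⁺ (suc n)) (just false) → Segment n t
        through (S.path y _ ye good (r , s≤r , r<e , yr∈ , yr≈)) = record
          { end   = record { time = e ; time∈ = e∈
                           ; late = ≤-trans (≤-trans (m≤n+m _ (suc (time t))) le) (<⇒≤ s<e) }
          ; later = ≤-trans t<r+1 r<e
          ; route = proj₁ (S.join n (<⇒≤ t<r+1) r<e
              (proj₂ (S.loops n) (time t) (late t) (suc r) (time∈ t) r+1∈ t<r+1 (proj₁ (goal n)) (proj₁ (proj₂ (goal n))))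
              (S.path {v = nothing} y yr≈ (≈-≤ (level≤nextLevel (suc n) (node (suc n))) ye)
                (λ i le i<e → good-mono (level≤nextLevel (suc n) (node (suc n)))
                                (good i (≤-trans s≤r (≤-trans (n≤1+n r) le)) i<e)) tt)) }
          where
          t<r+1 : time t < suc r
          t<r+1 = m≤n⇒m≤1+n (≤-trans (≤-trans (m≤m+n (suc (time t)) _) le) s≤r)

          r+1∈ : c′ (S.d⁺ n) (suc r) ≡ true
          -- Goodness identifies row `ρ (S.d⁺ n)` of `y` with row `S.d⁺ n` of `c′` at time `suc r`.
          r+1∈ = trans (sym (proj₂ (good r s≤r r<e) (S.d⁺ n) (d<nextLevel (suc n) (node (suc n)))
                                     (ρd<nextLevel (suc n) (node (suc n))))) yr∈

    -- Gluing the segments into one family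

    times : ∀ n → Time n
    times zero    = record { late = proj₁ (proj₂ first) ; time∈ = proj₂ (proj₂ first) }
      where
      first : Σ ℕ λ t → proj₁ (S.loops 0) ≤ t × c′ (S.d⁺ 0) t ≡ true
      first = S.infinite 0 (proj₁ (S.loops 0))
    times (suc n) = Segment.end (segment n (times n))

    T : ℕ → ℕ
    T n = time (times n)

    T-suc : ∀ n → T n < T (suc n)
    T-suc n = Segment.later (segment n (times n))

    T-mono : ∀ {m n} → m ≤′ n → T m ≤ T n
    T-mono ≤′-refl       = ≤-refl
    T-mono (≤′-step m≤n) = ≤-trans (T-mono m≤n) (<⇒≤ (T-suc _))

    n≤T : ∀ n → n ≤ T n
    n≤T zero    = z≤n
    n≤T (suc n) = ≤-<-trans (n≤T n) (T-suc n)

    -- The stage `n` with `T n ≤ t < T (suc n)`, and `0` before `T 0`; as `T` is strictly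
    -- increasing, it grows by at most one per step.
    stageAt : ℕ → ℕ
    stageAt zero = 0
    stageAt (suc t) with T (suc (stageAt t)) ≤? suc t
    ... | yes _ = suc (stageAt t)
    ... | no _  = stageAt t

    stageAt-upper : ∀ t → t < T (suc (stageAt t))
    stageAt-upper zero = ≤-<-trans z≤n (T-suc 0)
    stageAt-upper (suc t) with T (suc (stageAt t)) ≤? suc t
    ... | yes T≤ = ≤-<-trans (stageAt-upper t) (T-suc (suc (stageAt t)))
    ... | no T≰  = ≰⇒> T≰

    stageAt-lower : ∀ t → stageAt t ≡ 0 ⊎ T (stageAt t) ≤ t
    stageAt-lower zero = inj₁ refl
    stageAt-lower (suc t) with T (suc (stageAt t)) ≤? suc t
    ... | yes T≤ = inj₂ T≤
    ... | no _ with stageAt-lower t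
    ...   | inj₁ eq = inj₁ eq
    ...   | inj₂ le = inj₂ (m≤n⇒m≤1+n le)

    T-stageAt : ∀ {t} → T 0 ≤ t → T (stageAt t) ≤ t
    T-stageAt {t} T₀≤t with stageAt t | stageAt-lower t
    ... | _ | inj₁ refl = T₀≤t
    ... | _ | inj₂ le   = le

    ≤stageAt : ∀ {n t} → T n ≤ t → n ≤ stageAt t
    ≤stageAt {n} {t} Tn≤t with ≤-<-connex n (stageAt t)
    ... | inj₁ le = le
    ... | inj₂ lt = contradiction (≤-trans (T-mono (≤⇒≤′ lt)) Tn≤t) (<⇒≱ (stageAt-upper t))

    stageAt-unique : ∀ {n t} → T n ≤ t → t < T (suc n) → stageAt t ≡ n
    stageAt-unique {n} {t} Tn≤t t<T with m≤n⇒m<n∨m≡n (≤stageAt Tn≤t)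
    ... | inj₂ eq = sym eq
    ... | inj₁ lt = contradiction
      (≤-trans (T-mono (≤⇒≤′ lt)) (T-stageAt (≤-trans (T-mono {n = n} (≤⇒≤′ z≤n)) Tn≤t))) (<⇒≱ t<T)

    route : ∀ n → S.Path n (col c′) (T n) (T (suc n)) (S.p⁺ n) (S.p⁺ (suc n)) (proj₁ (goal n))
    route n = Segment.route (segment n (times n))

    trace : ℕ → ℕ → State
    trace n = S.Path.trace (route n)

    v : ℕ → Subset
    v i t = trace (stageAt t) t i

    -- When `suc t` is `T (suc n)` the next trace takes over; both traces agree there with
    -- `S.p⁺ (suc n)` on the first `ℓ n` rows.
    v-next : ∀ t → trace (stageAt t) (suc t) ≈[ ℓ (stageAt t) ] col v (suc t)
    v-next t with T (suc (stageAt t)) ≤? suc t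
    ... | no _   = ≈-refl
    ... | yes T≤ = at (≤-antisym (stageAt-upper t) T≤)
      where
      n : ℕ
      n = stageAt t

      at : ∀ {s} → s ≡ T (suc n) → trace n s ≈[ ℓ n ] trace (suc n) s
      at refl = ≈-trans (S.Path.target (route n))
        (≈-≤ (level≤nextLevel (suc n) (node (suc n))) (≈-sym (S.Path.source (route (suc n)))))

    v-good : ∀ {t} → T 0 ≤ t → Good (ℓ (stageAt t)) (col c′ (suc t)) (col v t) (col v (suc t))
    v-good {t} T₀≤t = good-local (ℓ (stageAt t)) ≈-refl ≈-refl (v-next t)
      (S.Path.good (route (stageAt t)) t (T-stageAt T₀≤t) (stageAt-upper t))

    v-good-at : ∀ k → Ev (λ t → Good k (col c′ (suc t)) (col v t) (col v (suc t)))
    v-good-at k = T k , λ t Tk≤t → good-mono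
      (≤-trans (≤stageAt Tk≤t) (n≤nextLevel (stageAt t) (node (stageAt t))))
      (v-good (≤-trans (T-mono {n = k} (≤⇒≤′ z≤n)) Tk≤t))

    v≼u : v ≼ u
    v≼u k p q io with _ , _ , (rec , _) , hp , hq ← Ev-IO (v-good-at k) io 0 = recurs-local k hp hq rec

    u≼v : u ≼ v
    u≼v k p q io M = found (subst (S.Visits n (trace n) (T n) (T (suc n))) v≡ (S.Path.visits (route n)))
      where
      n : ℕ
      -- The first component makes `n` at least `M`, so the segment of stage `n` starts no earlier
      -- than `M`.
      n = pair M (pair k (pair (code k p) (code k q)))

      task≡ : task n ≡ (k , code k p , code k q)
      task≡ rewrite unpair-pair M (pair k (pair (code k p) (code k q)))
                  | unpair-pair k (pair (code k p) (code k q)) | unpair-pair (code k p) (code k q) = refl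

      occurs : Occurs (Target n (node n)) (just true)
      occurs = IO-map (λ t (hp , hq) → subst (λ τ → Meets τ (col u t) (col u (suc t))) (sym task≡)
        (≈-trans hp (≈-sym (decode-code k p)) , ≈-trans hq (≈-sym (decode-code k q)))) io

      v≡ : proj₁ (goal n) ≡ just true
      v≡ = proj₂ (proj₂ (goal n)) occurs

      k≤ℓ : k ≤ ℓ n
      k≤ℓ = subst (_≤ ℓ n) (cong proj₁ task≡) (taskLevel≤ n (node n))

      at : ∀ {r} → stageAt r ≡ n → trace (stageAt r) (suc r) ≈[ ℓ (stageAt r) ] col v (suc r) →
        Meets (k , code k p , code k q) (trace n r) (trace n (suc r)) → Edge k v p q r
      at {r} eq seam (hx , hy) =
        ≈-trans (λ i _ → cong (λ m → trace m r i) eq) (≈-trans hx (decode-code k p)) ,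
        ≈-trans (≈-sym (≈-≤ k≤ℓ (subst (λ m → trace m (suc r) ≈[ ℓ m ] col v (suc r)) eq seam)))
                (≈-trans hy (decode-code k q))

      found : S.Visits n (trace n) (T n) (T (suc n)) (just true) → Σ ℕ λ t → M ≤ t × Edge k v p q t
      found (r , T≤r , r<T , hit) = r , ≤-trans (m≤pair M _) (≤-trans (n≤T n) T≤r) ,
        at (stageAt-unique T≤r r<T) (v-next r) (subst (λ τ → Meets τ (trace n r) (trace n (suc r))) task≡ hit)

    v-extends : ∀ i → v (ρ i) =* c′ i
    v-extends i with M , h ← v-good-at (suc (i + ρ i)) = suc M , λ
      { (suc t) (s≤s M≤t) → proj₂ (h t M≤t) i (s≤s (m≤m+n i (ρ i))) (s≤s (m≤n+m (ρ i) i)) }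

  opaque
    extend : (u : ℕ → Subset) (ρ : ℕ → ℕ) (c′ : ℕ → Subset) → u ∘ ρ ≃ c′ → Rich (u ∘ ρ) →
      Σ (ℕ → Subset) λ v → u ≃ v × ∀ i → v (ρ i) =* c′ i
    extend u ρ c′ c≃c′ rich = v , (u≼v , v≼u) , v-extends
      where open Extension u ρ c′ c≃c′ rich

  -- Elementary substructures and embeddings

  ⊓-cong : ∀ {A A′ B B′} → A =* A′ → B =* B′ → (A ⊓ B) =* (A′ ⊓ B′)
  ⊓-cong p q = Ev-map (λ _ (p , q) → cong₂ _∧_ p q) (Ev-× p q)

  ⊔-cong : ∀ {A A′ B B′} → A =* A′ → B =* B′ → (A ⊔ B) =* (A′ ⊔ B′)
  ⊔-cong p q = Ev-map (λ _ (p , q) → cong₂ _∨_ p q) (Ev-× p q)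

  ∁-cong : ∀ {A A′} → A =* A′ → ∁ A =* ∁ A′
  ∁-cong = Ev-map λ _ → cong not

  σ-cong : ∀ {A A′} → A =* A′ → σ A =* σ A′
  σ-cong (N , h) = suc N , λ { (suc n) (s≤s le) → h n le }

  σ⁻¹-cong : ∀ {A A′} → A =* A′ → σ⁻¹ A =* σ⁻¹ A′
  σ⁻¹-cong = Ev-suc

  σ-σ⁻¹ : ∀ A → σ (σ⁻¹ A) =* A
  σ-σ⁻¹ A = 1 , λ { (suc n) _ → refl }

  [≔]-same : ∀ {x k b} → (x [ k ≔ b ]) k ≡ b
  [≔]-same {k = k} with k ≟ k
  ... | yes _  = refl
  ... | no k≢k = contradiction refl k≢k

  [≔]-other : ∀ {x k b i} → k < i → (x [ k ≔ b ]) i ≡ x i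
  [≔]-other {k = k} {i = i} k<i with i ≟ k
  ... | yes refl = contradiction k<i (<-irrefl refl)
  ... | no _     = refl

  -- Shannon expansion: the value of F at the state whose first k entries are the values of the literals L.
  expand : ℕ → (ℕ → Term) → (State → Term) → State → Term
  expand zero    L F x = F x
  expand (suc k) L F x =
    (L k ⊓ᵗ expand k L F (x [ k ≔ true ])) ⊔ᵗ (∁ᵗ (L k) ⊓ᵗ expand k L F (x [ k ≔ false ]))

  expand-correct : ∀ k L F x ρ n → Σ State λ x′ → (∀ i → i < k → x′ i ≡ ⟦ L i ⟧ᵗ ρ n) ×
    (∀ i → k ≤ i → x′ i ≡ x i) × ⟦ expand k L F x ⟧ᵗ ρ n ≡ ⟦ F x′ ⟧ᵗ ρ n
  expand-correct zero    L F x ρ n = x , (λ _ ()) , (λ _ _ → refl) , refl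
  expand-correct (suc k) L F x ρ n = choose (⟦ L k ⟧ᵗ ρ n) refl
    where
    choose : ∀ b → ⟦ L k ⟧ᵗ ρ n ≡ b → Σ State λ x′ → (∀ i → i < suc k → x′ i ≡ ⟦ L i ⟧ᵗ ρ n) ×
      (∀ i → suc k ≤ i → x′ i ≡ x i) × ⟦ expand (suc k) L F x ⟧ᵗ ρ n ≡ ⟦ F x′ ⟧ᵗ ρ n
    choose b eq with x′ , below , above , val ← expand-correct k L F (x [ k ≔ b ]) ρ n = x′ ,
      (λ i lt → entry i (m<1+n⇒m<n∨m≡n lt)) , (λ i k<i → trans (above i (<⇒≤ k<i)) ([≔]-other {x} {k} {b} k<i)) ,
      trans (branch b eq) val
      where
      entry : ∀ i → i < k ⊎ i ≡ k → x′ i ≡ ⟦ L i ⟧ᵗ ρ n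
      entry i (inj₁ i<k)  = below i i<k
      entry i (inj₂ refl) = trans (above i ≤-refl) (trans ([≔]-same {x} {k} {b}) (sym eq))

      branch : ∀ b → ⟦ L k ⟧ᵗ ρ n ≡ b → ⟦ expand (suc k) L F x ⟧ᵗ ρ n ≡ ⟦ expand k L F (x [ k ≔ b ]) ⟧ᵗ ρ n
      branch true  eq rewrite eq = ∨-identityʳ _
      branch false eq rewrite eq = refl

  -- The literals `var i` read the rows at `n` and `σ⁻¹ᵗ (var i)` reads them at `suc n`; each leaf
  -- is the constant that decides `P`.
  termOf : ℕ → (State → State → Set) → Term
  termOf k P = expand k var
    (λ x → expand k (σ⁻¹ᵗ ∘ var) (λ y → if char (P x y) then oneᵗ else zeroᵗ) (λ _ → false)) (λ _ → false)

  module _ {k : ℕ} {P : State → State → Set} (local : Local k P) (ρ : ℕ → Subset) where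

    termOf-correct : ∀ n → (⟦ termOf k P ⟧ᵗ ρ n ≡ true → P (col ρ n) (col ρ (suc n))) ×
                           (P (col ρ n) (col ρ (suc n)) → ⟦ termOf k P ⟧ᵗ ρ n ≡ true)
    termOf-correct n
      with x , x≈ , _ , valx ← expand-correct k var
             (λ x → expand k (σ⁻¹ᵗ ∘ var) (λ y → if char (P x y) then oneᵗ else zeroᵗ) (λ _ → false)) (λ _ → false) ρ n
      with y , y≈ , _ , valy ← expand-correct k (σ⁻¹ᵗ ∘ var)
             (λ y → if char (P x y) then oneᵗ else zeroᵗ) (λ _ → false) ρ n
      = (λ eq → local x≈ y≈ (to (trans (sym (trans valx valy)) eq))) ,
        (λ p → trans (trans valx valy) (from (local (≈-sym x≈) (≈-sym y≈) p)))
      where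
      to : ⟦ if char (P x y) then oneᵗ else zeroᵗ ⟧ᵗ ρ n ≡ true → P x y
      to h with char (P x y) in eq
      ... | true = char-out eq

      from : P x y → ⟦ if char (P x y) then oneᵗ else zeroᵗ ⟧ᵗ ρ n ≡ true
      from p rewrite char-in p = refl

    termOf-empty : ⟦ termOf k P ⟧ᵗ ρ =* 𝟎 → ¬ IO (λ n → P (col ρ n) (col ρ (suc n)))
    termOf-empty ev io with n , _ , eq , p ← Ev-IO ev io 0 with () ← trans (sym (proj₂ (termOf-correct n) p)) eq

    termOf-nonempty : ¬ (⟦ termOf k P ⟧ᵗ ρ =* 𝟎) → IO (λ n → P (col ρ n) (col ρ (suc n)))
    termOf-nonempty ¬ev = ¬Ev¬→IO λ ev →
      ¬ev (Ev-map (λ n ¬p → ¬-not λ eq → ¬p (proj₁ (termOf-correct n) eq)) ev)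

    termOf-full : Ev (λ n → P (col ρ n) (col ρ (suc n))) → ⟦ termOf k P ⟧ᵗ ρ =* 𝟏
    termOf-full = Ev-map λ n → proj₂ (termOf-correct n)

    termOf-full⁻ : ⟦ termOf k P ⟧ᵗ ρ =* 𝟏 → Ev (λ n → P (col ρ n) (col ρ (suc n)))
    termOf-full⁻ = Ev-map λ n → proj₁ (termOf-correct n)

  edge-local : ∀ k p q → Local k (λ x y → x ≈[ k ] p × y ≈[ k ] q)
  edge-local k p q x≈ y≈ (hx , hy) = ≈-trans (≈-sym x≈) hx , ≈-trans (≈-sym y≈) hy

  ∃ⁿ : ℕ → Formula → Formula
  ∃ⁿ zero    φ = φ
  ∃ⁿ (suc m) φ = ∃ᶠ (∃ⁿ m φ)

  prepend : ℕ → (ℕ → Subset) → Valuation → Valuation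
  prepend zero    x ρ = ρ
  prepend (suc m) x ρ = prepend m x (x m ∷ᵛ ρ)

  prepend-≥ : ∀ m x ρ i → prepend m x ρ (m + i) ≡ ρ i
  prepend-≥ zero    x ρ i = refl
  prepend-≥ (suc m) x ρ i =
    trans (cong (prepend m x (x m ∷ᵛ ρ)) (sym (+-suc m i))) (prepend-≥ m x (x m ∷ᵛ ρ) (suc i))

  prepend-< : ∀ m x ρ i → i < m → prepend m x ρ i ≡ x i
  prepend-< (suc m) x ρ i i<sm with m<1+n⇒m<n∨m≡n i<sm
  ... | inj₁ i<m  = prepend-< m x (x m ∷ᵛ ρ) i i<m
  ... | inj₂ refl = trans (cong (prepend m x (x m ∷ᵛ ρ)) (sym (+-identityʳ m))) (prepend-≥ m x (x m ∷ᵛ ρ) 0)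

  ∃ⁿ-intro : ∀ m x ρ φ → Sat Full (prepend m x ρ) φ → Sat Full ρ (∃ⁿ m φ)
  ∃ⁿ-intro zero    x ρ φ sat = sat
  ∃ⁿ-intro (suc m) x ρ φ sat = x m , tt , ∃ⁿ-intro m x (x m ∷ᵛ ρ) φ sat

  ∃ⁿ-elim : ∀ {D} m ρ φ → Sat D ρ (∃ⁿ m φ) →
    Σ Valuation λ ρ′ → Sat D ρ′ φ × (∀ i → i < m → D (ρ′ i)) × ∀ i → ρ′ (m + i) ≡ ρ i
  ∃ⁿ-elim zero ρ φ sat = ρ , sat , (λ _ ()) , λ _ → refl
  ∃ⁿ-elim {D} (suc m) ρ φ (x , x∈D , sat) with ρ′ , sat′ , in-D , old ← ∃ⁿ-elim m (x ∷ᵛ ρ) φ sat =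
    ρ′ , sat′ , (λ i lt → new i (m<1+n⇒m<n∨m≡n lt)) , λ i → trans (cong ρ′ (sym (+-suc m i))) (old (suc i))
    where
    new : ∀ i → i < m ⊎ i ≡ m → D (ρ′ i)
    new i (inj₁ i<m)  = in-D i i<m
    new i (inj₂ refl) = subst D (trans (sym (old 0)) (cong ρ′ (+-identityʳ m))) x∈D

  module _ {a : ℕ → Subset} (elem : IsElementarySubstructure a) where

    open IsElementarySubstructure elem

    -- For fixed `e`, the existence of the set and the record is one formula with parameters in 𝔸,
    -- true in P(ω)/Fin by Ramsey's theorem. Elementarity provides witnesses in 𝔸, and the
    -- idempotence of `e` carries over unchanged.
    elementary-rich : Rich a
    elementary-rich N A with D , τ , e , wit ← witness-exists A (col a)
      = proj₁ (κ 0 (s≤s z≤n)) , proj₁ index , e ,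
        witness-cong A (0 , λ t _ i _ → cong (λ f → f t) (old i)) (proj₂ (κ 0 (s≤s z≤n))) (proj₂ index) (Sat→witness (proj₁ found) sat′)
      where
      m : ℕ
      m = suc N

      -- Variable `0` is the set, the next `N` variables are the record, and those from `m` on are
      -- the parameters.
      P Q : State → State → Set
      P x y = y ∘ suc ≈[ N ] step A (y ∘ (m +_)) (if x 0 then start A else x ∘ suc) ×
              (x 0 ≡ true → x ∘ suc ≈[ N ] e)
      Q x y = x 0 ≡ true

      K : ℕ
      K = m + width A

      letters : ∀ {x x′ : State} → x ≈[ K ] x′ → x ∘ (m +_) ≈[ width A ] x′ ∘ (m +_)
      letters x≈ i lt = x≈ (m + i) (+-monoʳ-< m lt)

      tracker : ∀ {x x′ : State} → x ≈[ K ] x′ → x ∘ suc ≈[ N ] x′ ∘ suc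
      tracker x≈ i lt = x≈ (suc i) (≤-trans (s≤s lt) (m≤m+n m _))

      P-local : Local K P
      P-local {x} {x′} x≈ y≈ (tr , ret) with x 0 | x′ 0 | x≈ 0 (s≤s z≤n)
      ... | true  | _ | refl = ≈-trans (≈-sym (tracker y≈)) (≈-trans tr (local A (letters y≈) ≈-refl)) ,
                               λ h → ≈-trans (≈-sym (tracker x≈)) (ret h)
      ... | false | _ | refl = ≈-trans (≈-sym (tracker y≈)) (≈-trans tr (local A (letters y≈) (tracker x≈))) ,
                               λ ()

      Q-local : Local K Q
      Q-local x≈ _ h = trans (sym (x≈ 0 (s≤s z≤n))) h

      ψ : Formula
      ψ = (termOf K P ≐ oneᵗ) ∧ᶠ ¬ᶠ (termOf K Q ≐ zeroᵗ)

      witness→Sat : ∀ ρ → Witness A (col (ρ ∘ (m +_))) (ρ 0) (ρ ∘ suc) e → Sat Full ρ ψ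
      witness→Sat ρ (witness inf tr ret _) =
        termOf-full P-local ρ (Ev-× tr ret) , λ ev → termOf-empty Q-local ρ ev inf

      Sat→witness : ∀ ρ → Sat (In a) ρ ψ → Witness A (col (ρ ∘ (m +_))) (ρ 0) (ρ ∘ suc) e
      Sat→witness ρ (full , nonempty) = witness (termOf-nonempty Q-local ρ nonempty)
        (Ev-map (λ _ → proj₁) ev) (Ev-map (λ _ → proj₂) ev) (Witness.idempotent wit)
        where
        ev : Ev (λ n → P (col ρ n) (col ρ (suc n)))
        ev = termOf-full⁻ P-local ρ full

      new : ℕ → Subset
      new zero    = D
      new (suc i) = τ i

      sat : Sat Full a (∃ⁿ m ψ)
      sat = ∃ⁿ-intro m new a ψ (witness→Sat (prepend m new a) (witness-cong A
        (0 , λ t _ i _ → cong (λ f → f t) (sym (prepend-≥ m new a i)))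
        (=*-reflexive (sym (prepend-< m new a 0 (s≤s z≤n))))
        (λ i lt → =*-reflexive (sym (prepend-< m new a (suc i) (s≤s lt)))) wit))

      found : Σ Valuation λ ρ′ → Sat (In a) ρ′ ψ × (∀ i → i < m → In a (ρ′ i)) × ∀ i → ρ′ (m + i) ≡ a i
      found = ∃ⁿ-elim m a ψ (proj₂ (elementary (∃ⁿ m ψ) a (λ i → i , =*-refl)) sat)

      sat′ : Sat (In a) (proj₁ found) ψ
      sat′ = proj₁ (proj₂ found)

      κ : ∀ i → i < m → In a (proj₁ found i)
      κ = proj₁ (proj₂ (proj₂ found))

      old : ∀ i → proj₁ found (m + i) ≡ a i
      old = proj₂ (proj₂ (proj₂ found))

      index : Σ (ℕ → ℕ) λ f → ∀ i → i < N → proj₁ found (suc i) =* a (f i)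
      index = choose-below N λ i lt → κ (suc i) (s≤s lt)

    in-term : ∀ t → In a (⟦ t ⟧ᵗ a)
    in-term (var i)  = i , =*-refl
    in-term zeroᵗ    = has-𝟎
    in-term oneᵗ     = has-𝟏
    in-term (s ⊓ᵗ t) = close-⊓ _ _ (in-term s) (in-term t)
    in-term (s ⊔ᵗ t) = close-⊔ _ _ (in-term s) (in-term t)
    in-term (∁ᵗ t)   = close-∁ _ (in-term t)
    in-term (σᵗ t)   = close-σ _ (in-term t)
    in-term (σ⁻¹ᵗ t) = close-σ⁻¹ _ (in-term t)

    module _ {η : Subset → Subset} (emb : IsEmbedding a η) where

      open IsEmbedding emb

      comm-σ⁻¹ : ∀ x → In a x → η (σ⁻¹ x) =* σ⁻¹ (η x)
      comm-σ⁻¹ x x∈ = σ⁻¹-cong (=*-trans (=*-sym (comm-σ (σ⁻¹ x) (close-σ⁻¹ x x∈)))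
        (well-defined _ x (close-σ _ (close-σ⁻¹ x x∈)) x∈ (σ-σ⁻¹ x)))

      η-term : ∀ t → η (⟦ t ⟧ᵗ a) =* ⟦ t ⟧ᵗ (η ∘ a)
      η-term (var i)  = =*-refl
      η-term zeroᵗ    = pres-𝟎
      η-term oneᵗ     = pres-𝟏
      η-term (s ⊓ᵗ t) = =*-trans (pres-⊓ _ _ (in-term s) (in-term t)) (⊓-cong (η-term s) (η-term t))
      η-term (s ⊔ᵗ t) = =*-trans (pres-⊔ _ _ (in-term s) (in-term t)) (⊔-cong (η-term s) (η-term t))
      η-term (∁ᵗ t)   = =*-trans (pres-∁ _ (in-term t)) (∁-cong (η-term t))
      η-term (σᵗ t)   = =*-trans (comm-σ _ (in-term t)) (σ-cong (η-term t))
      η-term (σ⁻¹ᵗ t) = =*-trans (comm-σ⁻¹ _ (in-term t)) (σ⁻¹-cong (η-term t))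

      -- A pattern recurs when its term is nonzero. Injectivity keeps nonzero terms nonzero under
      -- `η`, and well-definedness keeps zero terms zero.
      embedding-≃ : a ≃ η ∘ a
      embedding-≃ =
        (λ k p q io → termOf-nonempty (edge-local k p q) (η ∘ a) λ empty →
          termOf-empty (edge-local k p q) a (injective _ _ (in-term (t k p q)) has-𝟎
            (=*-trans (η-term (t k p q)) (=*-trans empty (=*-sym pres-𝟎)))) io) ,
        (λ k p q io → termOf-nonempty (edge-local k p q) a λ empty →
          termOf-empty (edge-local k p q) (η ∘ a) (=*-trans (=*-sym (η-term (t k p q)))
            (=*-trans (well-defined _ _ (in-term (t k p q)) has-𝟎 empty) pres-𝟎)) io)
        where
        t : ℕ → State → State → Term
        t k p q = termOf k λ x y → x ≈[ k ] p × y ≈[ k ] q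

  -- The tower of partial isomorphisms

  Pairing : Set
  Pairing = (ℕ → Subset) × (ℕ → Subset)

  infix 4 _⊑_

  _⊑_ : Pairing → Pairing → Set
  (L , R) ⊑ (L′ , R′) = ∀ i → Σ ℕ λ j → L i =* L′ j × R i =* R′ j

  ⊑-refl : ∀ {P} → P ⊑ P
  ⊑-refl i = i , =*-refl , =*-refl

  ⊑-trans : ∀ {P Q S} → P ⊑ Q → Q ⊑ S → P ⊑ S
  ⊑-trans P⊑Q Q⊑S i with j , l , r ← P⊑Q i with k , l′ , r′ ← Q⊑S j = k , =*-trans l l′ , =*-trans r r′

  -- The notion is symmetric, since `rich-≃` gives the richness of `R` from that of `L`.
  PartialIso : Pairing → Set
  PartialIso (L , R) = L ≃ R × Rich L

  ≼-cong : ∀ {u u′ v v′} → (∀ i → u i =* u′ i) → (∀ i → v i =* v′ i) → u ≼ v → u′ ≼ v′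
  ≼-cong {u} {_} {v} u≈ v≈ u≼v = ≼-directed λ k →
    u , v , u≼v , id , λ j _ → =*-sym (u≈ j) , =*-sym (v≈ j)

  rich-cong : ∀ {u u′} → (∀ i → u i =* u′ i) → Rich u → Rich u′
  rich-cong {u} u≈ rich = rich-directed λ k →
    u , (id , λ j _ → =*-sym (u≈ j)) , richIn-⊆ (λ i → i , u≈ i) rich

  partialIso-cong : ∀ {L L′ R R′} → (∀ i → L i =* L′ i) → (∀ i → R i =* R′ i) →
    PartialIso (L , R) → PartialIso (L′ , R′)
  partialIso-cong L≈ R≈ ((L≼R , R≼L) , rich) = (≼-cong L≈ R≈ L≼R , ≼-cong R≈ L≈ R≼L) , rich-cong L≈ rich

  CoversLeft CoversRight : Subset → Pairing → Set
  CoversLeft  z (L , R) = Σ ℕ λ i → L i =* z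
  CoversRight z (L , R) = Σ ℕ λ i → R i =* z

  opaque
    -- `z` is put in front of the left family, the result is closed to a rich family `u`, and
    -- `extend` supplies partners for all of `u`.
    forth : ∀ P z → PartialIso P → Σ Pairing λ Q → PartialIso Q × P ⊑ Q × CoversLeft z Q
    forth (c , c′) z iso = (u , v) , (u≃v , u-rich) , (λ i → ρ i , c≈ i , =*-sym (v⊇ i)) , pair 0 0 , =*-reflexive (u⊇ 0)
      where
      s : ℕ → Subset
      s zero    = z
      s (suc i) = c i

      closed : Σ (ℕ → Subset) λ u → Rich u × ∀ i → u (pair 0 i) ≡ s i
      closed = rich-closure s

      open Σ closed renaming (proj₁ to u)
      open Σ (proj₂ closed) renaming (proj₁ to u-rich; proj₂ to u⊇)

      ρ : ℕ → ℕ
      ρ i = pair 0 (suc i)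

      c≈ : ∀ i → c i =* u (ρ i)
      c≈ i = =*-reflexive (sym (u⊇ (suc i)))

      iso′ : PartialIso (u ∘ ρ , c′)
      iso′ = partialIso-cong c≈ (λ _ → =*-refl) iso

      extended : Σ (ℕ → Subset) λ v → u ≃ v × ∀ i → v (ρ i) =* c′ i
      extended = extend u ρ c′ (proj₁ iso′) (proj₂ iso′)

      open Σ extended renaming (proj₁ to v)
      open Σ (proj₂ extended) renaming (proj₁ to u≃v; proj₂ to v⊇)

  swap : Pairing → Pairing
  swap (L , R) = R , L

  opaque
    partialIso-swap : ∀ P → PartialIso P → PartialIso (swap P)
    partialIso-swap P (L≃R@(L≼R , R≼L) , rich) = (R≼L , L≼R) , rich-≃ L≃R rich

  opaque
    back : ∀ P z → PartialIso P → Σ Pairing λ Q → PartialIso Q × P ⊑ Q × CoversRight z Q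
    back P z iso = let Q , iso′ , P⊑Q , cov = forth (swap P) z (partialIso-swap P iso) in
      swap Q , partialIso-swap Q iso′ , (λ i → let j , r , l = P⊑Q i in j , l , r) , cov

  module ChainUnion (P : ℕ → Pairing) (isos : ∀ n → PartialIso (P n))
    (chain : ∀ m n → P m ⊑ P n ⊎ P n ⊑ P m) where

    union : Pairing
    union = (λ j → let n , i = unpair j in proj₁ (P n) i) , (λ j → let n , i = unpair j in proj₂ (P n) i)

    ⊑-union : ∀ n → P n ⊑ union
    ⊑-union n i = pair n i , =*-reflexive (cong (λ (m , j) → proj₁ (P m) j) (sym (unpair-pair n i))) ,
                             =*-reflexive (cong (λ (m , j) → proj₂ (P m) j) (sym (unpair-pair n i)))

    opaque
      upper-bound : ∀ K → Σ ℕ λ m → ∀ n → n < K → P n ⊑ P m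
      upper-bound zero = 0 , λ _ ()
      upper-bound (suc K) with m , h ← upper-bound K with chain K m
      ... | inj₁ K⊑m = m , λ n lt → [ h n , (λ { refl → K⊑m }) ]′ (m<1+n⇒m<n∨m≡n lt)
      ... | inj₂ m⊑K = K , λ n lt → [ (λ n<K → ⊑-trans (h n n<K) m⊑K) , (λ { refl → ⊑-refl }) ]′ (m<1+n⇒m<n∨m≡n lt)

      initial-rows : ∀ k → Σ ℕ λ m → Σ (ℕ → ℕ) λ f → ∀ j → j < k →
        proj₁ union j =* proj₁ (P m) (f j) × proj₂ union j =* proj₂ (P m) (f j)
      initial-rows k with K , n<K ← bounded (proj₁ ∘ unpair) k with m , h ← upper-bound K =
        m , choose-below k λ j lt → h (proj₁ (unpair j)) (n<K j lt) (proj₂ (unpair j))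

    -- Each pattern and each automaton involves finitely many rows, and these lie in one member of
    -- the chain.
    union-iso : PartialIso union
    union-iso =
      (≼-directed (λ k → let m , f , h = initial-rows k in
         proj₁ (P m) , proj₂ (P m) , proj₁ (proj₁ (isos m)) , f , h) ,
       ≼-directed (λ k → let m , f , h = initial-rows k in
         proj₂ (P m) , proj₁ (P m) , proj₂ (proj₁ (isos m)) , f , λ j lt → let l , r = h j lt in r , l)) ,
      rich-directed λ k → let m , f , h = initial-rows k in
        proj₁ (P m) , (f , λ j lt → proj₁ (h j lt)) ,
        richIn-⊆ (λ i → let j , l , _ = ⊑-union m i in j , l) (proj₂ (isos m))

  -- Pairings are coded by single subsets so that the well-ordering of P(ω) can select among them.
  stage : Subset → Pairing
  stage w = (λ i n → w (pair 0 (pair i n))) , (λ i n → w (pair 1 (pair i n)))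

  stage-cong : ∀ {w w′} → w ≗ˢ w′ → stage w ⊑ stage w′
  stage-cong w≗ i = i , (0 , λ n _ → w≗ _) , (0 , λ n _ → w≗ _)

  encode : Pairing → Subset
  encode (L , R) m with unpair m
  ... | zero  , x = let i , n = unpair x in L i n
  ... | suc _ , x = let i , n = unpair x in R i n

  encode-left : ∀ L R i → L i =* proj₁ (stage (encode (L , R))) i
  encode-left L R i = 0 , λ n _ → sym (eq n)
    where
    eq : ∀ n → encode (L , R) (pair 0 (pair i n)) ≡ L i n
    eq n rewrite unpair-pair 0 (pair i n) | unpair-pair i n = refl

  encode-right : ∀ L R i → R i =* proj₂ (stage (encode (L , R))) i
  encode-right L R i = 0 , λ n _ → sym (eq n)
    where
    eq : ∀ n → encode (L , R) (pair 1 (pair i n)) ≡ R i n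
    eq n rewrite unpair-pair 1 (pair i n) | unpair-pair i n = refl

  -- Transfinite recursion along the well-ordering

  module Tower (init : Pairing) (init-iso : PartialIso init) (_≺_ : Subset → Subset → Set)
    (wf : WellFounded _≺_) (tri : ∀ x y → x ≺ y ⊎ x ≗ˢ y ⊎ y ≺ x)
    (countable : ∀ y → Σ (ℕ → Subset) λ e → ∀ x → x ≺ y → ∃ λ n → e n ≗ˢ x) where

    ≗-sym : ∀ {x y} → x ≗ˢ y → y ≗ˢ x
    ≗-sym h n = sym (h n)

    ≗-trans : ∀ {x y z} → x ≗ˢ y → y ≗ˢ z → x ≗ˢ z
    ≗-trans g h n = trans (g n) (h n)

    _≺⁺_ : Subset → Subset → Set
    _≺⁺_ = TransClosure _≺_

    -- Pointwise equal subsets need not be identical, and ≺ need not respect pointwise equality;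
    -- the recursion below therefore only looks at subsets that are ≺⁺-minimal in their class.
    Prime : Subset → Set
    Prime z = ∀ y → y ≗ˢ z → ¬ (y ≺⁺ z)

    prime-copy : ∀ x → Σ Subset λ z → z ≗ˢ x × Prime z
    prime-copy x = find x (wellFounded _≺_ wf x)
      where
      find : ∀ x → Acc _≺⁺_ x → Σ Subset λ z → z ≗ˢ x × Prime z
      find x (acc rs) with em (Σ Subset λ y → y ≗ˢ x × y ≺⁺ x)
      ... | no ¬ex = x , (λ _ → refl) , λ y y≗x y≺x → ¬ex (y , y≗x , y≺x)
      ... | yes (y , y≗x , y≺x) with z , z≗y , prime ← find y (rs y≺x) = z , ≗-trans z≗y y≗x , prime

    -- The other cases of trichotomy give a copy of `z` that is `≺⁺`-below `z`.
    prime-≺ : ∀ {y z z′} → Prime z → Prime z′ → z ≗ˢ z′ → y ≺ z → y ≺ z′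
    prime-≺ {y} {z} {z′} pz pz′ z≗z′ y≺z with tri y z′
    ... | inj₁ y≺z′        = y≺z′
    ... | inj₂ (inj₁ y≗z′) = contradiction [ y≺z ] (pz y (≗-trans y≗z′ (≗-sym z≗z′)))
    ... | inj₂ (inj₂ z′≺y) = contradiction (z′≺y ∷ [ y≺z ]) (pz z′ (≗-sym z≗z′))

    Least : (Subset → Set) → Subset → Set
    Least V w = V w × ∀ w′ → w′ ≺ w → ¬ V w′

    least-exists : ∀ {V w} → V w → Σ Subset (Least V)
    least-exists {V} {w} = descend w (wf w)
      where
      descend : ∀ w → Acc _≺_ w → V w → Σ Subset (Least V)
      descend w (acc rs) v with em (Σ Subset λ w′ → w′ ≺ w × V w′)
      ... | yes (w′ , w′≺w , v′) = descend w′ (rs w′≺w) v′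
      ... | no ¬ex               = w , v , λ w′ w′≺w v′ → ¬ex (w′ , w′≺w , v′)

    least : (Subset → Set) → Subset
    least V with em (Σ Subset (Least V))
    ... | yes (w , _) = w
    ... | no _        = 𝟎

    least-satisfies : ∀ {V w} → V w → V (least V)
    least-satisfies {V} v with em (Σ Subset (Least V))
    ... | yes (_ , v′ , _) = v′
    ... | no ¬ex           = contradiction (least-exists v) ¬ex

    -- Two least elements are compared by trichotomy, which yields pointwise equality only.
    least-cong : ∀ {V V′} → (∀ w → V w → V′ w) → (∀ w → V′ w → V w) → least V ≗ˢ least V′
    least-cong {V} {V′} f g with em (Σ Subset (Least V)) | em (Σ Subset (Least V′))
    ... | no _ | no _ = λ _ → refl
    ... | yes (_ , v , _) | no ¬ex = contradiction (least-exists (f _ v)) ¬ex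
    ... | no ¬ex | yes (_ , v , _) = contradiction (least-exists (g _ v)) ¬ex
    ... | yes (w , v , min) | yes (w′ , v′ , min′) with tri w w′
    ...   | inj₁ w≺w′        = contradiction (f w v) (min′ w w≺w′)
    ...   | inj₂ (inj₁ w≗w′) = w≗w′
    ...   | inj₂ (inj₂ w′≺w) = contradiction (g w′ v′) (min w′ w′≺w)

    record Valid (z : Subset) (g : ∀ y → y ≺ z → Subset) (w : Subset) : Set where
      field
        iso    : PartialIso (stage w)
        init⊑  : init ⊑ stage w
        left   : CoversLeft z (stage w)
        right  : CoversRight z (stage w)
        below⊑ : ∀ y (y≺z : y ≺ z) → Prime y → stage (g y y≺z) ⊑ stage w

    -- Choosing the ≺-least valid code makes the stage depend only on the class of z.
    code-at : ∀ z → Acc _≺_ z → Subset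
    code-at z (acc rs) = least (Valid z λ y y≺z → code-at y (rs y≺z))

    -- This covers two representatives as well as two accessibility proofs for the same one. By
    -- induction the earlier stages agree, so both codes are least for the same condition.
    code-at-cong : ∀ z (p : Acc _≺_ z) z′ (p′ : Acc _≺_ z′) → Prime z → Prime z′ → z ≗ˢ z′ →
      code-at z p ≗ˢ code-at z′ p′
    code-at-cong z (acc rs) z′ (acc rs′) pz pz′ z≗z′ = least-cong
      (λ w val → let open Valid val in record
        { iso = iso ; init⊑ = init⊑
        ; left = proj₁ left , =*-trans (proj₂ left) (0 , λ n _ → z≗z′ n)
        ; right = proj₁ right , =*-trans (proj₂ right) (0 , λ n _ → z≗z′ n)
        ; below⊑ = λ y y≺z′ py → let y≺z = prime-≺ pz′ pz (≗-sym z≗z′) y≺z′ in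
            ⊑-trans (stage-cong (≗-sym (code-at-cong y (rs y≺z) y (rs′ y≺z′) py py λ _ → refl))) (below⊑ y y≺z py) })
      (λ w val → let open Valid val in record
        { iso = iso ; init⊑ = init⊑
        ; left = proj₁ left , =*-trans (proj₂ left) (0 , λ n _ → sym (z≗z′ n))
        ; right = proj₁ right , =*-trans (proj₂ right) (0 , λ n _ → sym (z≗z′ n))
        ; below⊑ = λ y y≺z py → let y≺z′ = prime-≺ pz pz′ z≗z′ y≺z in
            ⊑-trans (stage-cong (code-at-cong y (rs y≺z) y (rs′ y≺z′) py py λ _ → refl)) (below⊑ y y≺z′ py) })

    stageOf : Subset → Pairing
    stageOf z = stage (code-at z (wf z))

    record CorrectCode (z w : Subset) : Set where
      field
        iso    : PartialIso (stage w)
        init⊑  : init ⊑ stage w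
        left   : CoversLeft z (stage w)
        right  : CoversRight z (stage w)
        below⊑ : ∀ y → y ≺ z → Prime y → stageOf y ⊑ stage w

    Correct : Subset → Set
    Correct z = CorrectCode z (code-at z (wf z))

    module Correct {z} (c : Correct z) = CorrectCode c

    stageOf-cong : ∀ {y z} → Prime y → Prime z → y ≗ˢ z → stageOf y ⊑ stageOf z
    stageOf-cong py pz y≗z = stage-cong (code-at-cong _ (wf _) _ (wf _) py pz y≗z)

    comparable : ∀ {y z} → Prime y → Prime z → Correct y → Correct z → stageOf y ⊑ stageOf z ⊎ stageOf z ⊑ stageOf y
    comparable {y} {z} py pz cy cz with tri y z
    ... | inj₁ y≺z        = inj₁ (Correct.below⊑ cz y y≺z py)
    ... | inj₂ (inj₁ y≗z) = inj₁ (stageOf-cong py pz y≗z)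
    ... | inj₂ (inj₂ z≺y) = inj₂ (Correct.below⊑ cy z z≺y pz)

    opaque
      -- By CH the predecessors of `z` are enumerated by some `e`, so their stages form a countable
      -- chain, whose union is the bound.
      bound-below : ∀ z → (∀ y → y ≺ z → Prime y → Correct y) →
        Σ Pairing λ Q → PartialIso Q × init ⊑ Q × ∀ y → y ≺ z → Prime y → stageOf y ⊑ Q
      bound-below z correct =
        ChainUnion.union P P-iso P-chain , ChainUnion.union-iso P P-iso P-chain ,
        ⊑-trans (init⊑P 0) (ChainUnion.⊑-union P P-iso P-chain 0) ,
        λ y y≺z py → let n , en≗y = proj₂ (countable z) y y≺z in
          ⊑-trans (below n y y≺z py en≗y) (ChainUnion.⊑-union P P-iso P-chain n)
        where
        e : ℕ → Subset
        e = proj₁ (countable z)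

        Earlier : ℕ → Set
        Earlier n = Σ Subset λ y → y ≺ z × Prime y × e n ≗ˢ y

        pick : ∀ n → Dec (Earlier n) → Pairing
        pick n (yes (y , _)) = stageOf y
        -- Entries of `e` that match no prime predecessor contribute `init`, which lies below every
        -- stage.
        pick n (no _)        = init

        P : ℕ → Pairing
        P n = pick n (em (Earlier n))

        P-iso : ∀ n → PartialIso (P n)
        P-iso n with em (Earlier n)
        ... | yes (y , y≺z , py , _) = Correct.iso (correct y y≺z py)
        ... | no _                   = init-iso

        init⊑P : ∀ n → init ⊑ P n
        init⊑P n with em (Earlier n)
        ... | yes (y , y≺z , py , _) = Correct.init⊑ (correct y y≺z py)
        ... | no _                   = ⊑-refl

        P-chain : ∀ m n → P m ⊑ P n ⊎ P n ⊑ P m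
        P-chain m n with em (Earlier m) | em (Earlier n) | init⊑P m | init⊑P n
        ... | no _ | _ | _ | i⊑n = inj₁ i⊑n
        ... | yes _ | no _ | i⊑m | _ = inj₂ i⊑m
        ... | yes (x , x≺z , px , _) | yes (y , y≺z , py , _) | _ | _ =
          comparable px py (correct x x≺z px) (correct y y≺z py)

        below : ∀ n y → y ≺ z → Prime y → e n ≗ˢ y → stageOf y ⊑ P n
        below n y y≺z py en≗y with em (Earlier n)
        ... | yes (x , _ , px , en≗x) = stageOf-cong py px (≗-trans (≗-sym en≗y) en≗x)
        ... | no ¬ex                  = contradiction (y , y≺z , py , en≗y) ¬ex

    opaque
      stage-exists : ∀ z → (∀ y → y ≺ z → Prime y → Correct y) →
        Σ Pairing λ Q → PartialIso Q × init ⊑ Q × CoversLeft z Q × CoversRight z Q ×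
          ∀ y → y ≺ z → Prime y → stageOf y ⊑ Q
      stage-exists z correct
        with Q₁ , iso₁ , init⊑ , below⊑ ← bound-below z correct
        with Q₂ , iso₂ , ⊑₂ , i , Li ← forth Q₁ z iso₁
        with Q₃ , iso₃ , ⊑₃ , right ← back Q₂ z iso₂
        = Q₃ , iso₃ , ⊑-trans init⊑ (⊑-trans ⊑₂ ⊑₃) ,
          (let j , l , _ = ⊑₃ i in j , =*-trans (=*-sym l) Li) , right ,
          λ y y≺z py → ⊑-trans (below⊑ y y≺z py) (⊑-trans ⊑₂ ⊑₃)

    correct : ∀ z → Prime z → Correct z
    correct z pz = at z (wf z) pz (wf z)
      where
      -- The first proof drives the recursion; the second is the one inside the code and is matched
      -- so that `code-at` unfolds.
      at : ∀ z → Acc _≺_ z → Prime z → ∀ p → CorrectCode z (code-at z p)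
      at z (acc rs) pz (acc rs′) = record
        { iso = Valid.iso val ; init⊑ = Valid.init⊑ val ; left = Valid.left val ; right = Valid.right val
        ; below⊑ = λ y y≺z py → ⊑-trans
            (stage-cong (code-at-cong y (wf y) y (rs′ y≺z) py py λ _ → refl)) (Valid.below⊑ val y y≺z py) }
        where
        below : ∀ y → y ≺ z → Subset
        below y y≺z = code-at y (rs′ y≺z)

        valid : (Σ Pairing λ Q → PartialIso Q × init ⊑ Q × CoversLeft z Q × CoversRight z Q ×
          ∀ y → y ≺ z → Prime y → stageOf y ⊑ Q) → Σ Subset (Valid z below)
        valid ((L , R) , iso , init⊑ , (i , Li) , (j , Rj) , below⊑) = encode (L , R) , record
          { iso = partialIso-cong (encode-left L R) (encode-right L R) iso
          ; init⊑ = ⊑-trans init⊑ enc ; left = i , =*-trans (=*-sym (encode-left L R i)) Li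
          ; right = j , =*-trans (=*-sym (encode-right L R j)) Rj
          ; below⊑ = λ y y≺z py → ⊑-trans
              (stage-cong (code-at-cong y (rs′ y≺z) y (wf y) py py λ _ → refl))
              (⊑-trans (below⊑ y y≺z py) enc) }
          where
          enc : (L , R) ⊑ stage (encode (L , R))
          enc i = i , encode-left L R i , encode-right L R i

        val : Valid z below (least (Valid z below))
        val = least-satisfies {Valid z below} (proj₂ (valid (stage-exists z λ y y≺z py → at y (rs y≺z) py (wf y))))

  -- The automorphism

  Has : Pairing → Subset → Subset → Set
  Has (L , R) x y = Σ ℕ λ i → L i =* x × R i =* y

  has-mono : ∀ {P Q x y} → P ⊑ Q → Has P x y → Has Q x y
  has-mono P⊑Q (i , l , r) with j , l′ , r′ ← P⊑Q i = j , =*-trans (=*-sym l′) l , =*-trans (=*-sym r′) r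

  module _ {L R : ℕ → Subset} (L≃R : L ≃ R) where

    -- Equality of two rows modulo finite is an eventual condition on columns, so it passes from `L`
    -- to `R`; constants, Boolean operations and the shift are treated in the same way.
    has-unique : ∀ {x x′ y y′} → Has (L , R) x y → Has (L , R) x′ y′ → x =* x′ → y =* y′
    has-unique (i , l , r) (j , l′ , r′) x≈x′ =
      =*-trans (=*-sym r) (=*-trans (Ev-transfer {suc (i + j)} {λ x _ → x i ≡ x j}
        (λ x≈ _ eq → trans (sym (x≈ i (s≤s (m≤m+n i j)))) (trans eq (x≈ j (s≤s (m≤n+m j i)))))
        (proj₂ L≃R) (=*-trans l (=*-trans x≈x′ (=*-sym l′)))) r′)

    has-constant : ∀ {x y} b → Has (L , R) x y → x =* (λ _ → b) → y =* (λ _ → b)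
    has-constant b (i , l , r) x≈b = =*-trans (=*-sym r)
      (Ev-transfer {suc i} {λ x _ → x i ≡ b} (λ x≈ _ eq → trans (sym (x≈ i ≤-refl)) eq)
        (proj₂ L≃R) (=*-trans l x≈b))

    has-op₂ : ∀ (_∙_ : Bool → Bool → Bool) {x y z x′ y′ z′} →
      Has (L , R) x x′ → Has (L , R) y y′ → Has (L , R) z z′ →
      z =* (λ n → x n ∙ y n) → z′ =* (λ n → x′ n ∙ y′ n)
    has-op₂ _∙_ (i , l₁ , r₁) (j , l₂ , r₂) (k , l₃ , r₃) z≈ = =*-trans (=*-sym r₃) (=*-trans
      (Ev-transfer {suc (i + j + k)} {λ x _ → x k ≡ x i ∙ x j}
        (λ x≈ _ eq → trans (sym (x≈ k (s≤s (m≤n+m k (i + j)))))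
          (trans eq (cong₂ _∙_ (x≈ i (s≤s (≤-trans (m≤m+n i j) (m≤m+n (i + j) k))))
                               (x≈ j (s≤s (≤-trans (m≤n+m j i) (m≤m+n (i + j) k)))))))
        (proj₂ L≃R)
        (=*-trans l₃ (=*-trans z≈ (Ev-map (λ _ (p , q) → cong₂ _∙_ (sym p) (sym q)) (Ev-× l₁ l₂)))))
      (Ev-map (λ _ (p , q) → cong₂ _∙_ p q) (Ev-× r₁ r₂)))

    -- `z =* σ x` relates row `k` at `suc n` to row `i` at `n`, a condition on two consecutive
    -- columns.
    has-σ : ∀ {x x′ z z′} → Has (L , R) x x′ → Has (L , R) z z′ → z =* σ x → z′ =* σ x′
    has-σ (i , l₁ , r₁) (k , l₃ , r₃) z≈ = =*-trans (=*-sym r₃) (=*-trans (pred-Ev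
      (Ev-transfer {suc (i + k)} {λ x y → y k ≡ x i}
        (λ x≈ y≈ eq → trans (sym (y≈ k (s≤s (m≤n+m k i)))) (trans eq (x≈ i (s≤s (m≤m+n i k)))))
        (proj₂ L≃R)
        (Ev-map (λ n (p , q) → trans p (sym q)) (Ev-× (Ev-suc (=*-trans l₃ z≈)) l₁))))
      (σ-cong r₁))
      where
      pred-Ev : ∀ {A B} → Ev (λ n → A (suc n) ≡ B n) → A =* σ B
      pred-Ev (N , h) = suc N , λ { (suc n) (s≤s le) → h n le }

  module Extended (init : Pairing) (init-iso : PartialIso init) (_≺_ : Subset → Subset → Set)
    (wf : WellFounded _≺_) (tri : ∀ x y → x ≺ y ⊎ x ≗ˢ y ⊎ y ≺ x)
    (countable : ∀ y → Σ (ℕ → Subset) λ e → ∀ x → x ≺ y → ∃ λ n → e n ≗ˢ x) where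

    open Tower init init-iso _≺_ wf tri countable

    prime : Subset → Subset
    prime x = proj₁ (prime-copy x)

    isPrime : ∀ x → Prime (prime x)
    isPrime x = proj₂ (proj₂ (prime-copy x))

    at : Subset → Pairing
    at x = stageOf (prime x)

    correct-at : ∀ x → Correct (prime x)
    correct-at x = correct (prime x) (isPrime x)

    covers-left : ∀ x → CoversLeft x (at x)
    covers-left x with i , eq ← Correct.left (correct-at x) =
      i , =*-trans eq (0 , λ n _ → proj₁ (proj₂ (prime-copy x)) n)

    covers-right : ∀ x → CoversRight x (at x)
    covers-right x with i , eq ← Correct.right (correct-at x) =
      i , =*-trans eq (0 , λ n _ → proj₁ (proj₂ (prime-copy x)) n)

    φ : Subset → Subset
    φ x = proj₂ (at x) (proj₁ (covers-left x))

    has-φ : ∀ x → Has (at x) x (φ x)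
    has-φ x = proj₁ (covers-left x) , proj₂ (covers-left x) , =*-refl

    record Common (x y : Subset) : Set where
      field
        top  : Subset
        x⊑   : at x ⊑ at top
        y⊑   : at y ⊑ at top

    common : ∀ x y → Common x y
    common x y with comparable (isPrime x) (isPrime y) (correct-at x) (correct-at y)
    ... | inj₁ x⊑y = record { top = y ; x⊑ = x⊑y ; y⊑ = ⊑-refl }
    ... | inj₂ y⊑x = record { top = x ; x⊑ = ⊑-refl ; y⊑ = y⊑x }

    iso-at : ∀ x → proj₁ (at x) ≃ proj₂ (at x)
    iso-at x = proj₁ (Correct.iso (correct-at x))

    -- The stages form a chain, so the given pair and the pair defining `φ x` lie in one stage,
    -- where `has-unique` applies.
    φ-unique : ∀ w {x y} → Has (at w) x y → φ x =* y
    φ-unique w {x} h = has-unique (iso-at top) (has-mono x⊑ (has-φ x)) (has-mono y⊑ h) =*-refl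
      where open Common (common x w)

    φ-init : ∀ {x y} → Has init x y → φ x =* y
    φ-init {x} h = φ-unique x (has-mono (Correct.init⊑ (correct-at x)) h)

    φ-op₂ : ∀ (_∙_ : Bool → Bool → Bool) x y → φ (λ n → x n ∙ y n) =* (λ n → φ x n ∙ φ y n)
    φ-op₂ _∙_ x y = has-op₂ (iso-at C′.top) _∙_
      (has-mono C′.x⊑ (has-mono C.x⊑ (has-φ x))) (has-mono C′.x⊑ (has-mono C.y⊑ (has-φ y)))
      (has-mono C′.y⊑ (has-φ _)) =*-refl
      where
      module C  = Common (common x y)
      module C′ = Common (common C.top (λ n → x n ∙ y n))

    φ-automorphism : IsShiftAutomorphism φ
    φ-automorphism = record
      { well-defined = λ x y x≈y → let open Common (common x y) in
          has-unique (iso-at top) (has-mono x⊑ (has-φ x)) (has-mono y⊑ (has-φ y)) x≈y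
      ; injective = λ x y φx≈φy → let open Common (common x y) ; L≼R , R≼L = iso-at top in
          has-unique (R≼L , L≼R) (flip (has-mono x⊑ (has-φ x))) (flip (has-mono y⊑ (has-φ y))) φx≈φy
      ; surjective = λ y → let i , eq = covers-right y in
          proj₁ (at y) i , φ-unique y (i , =*-refl , eq)
      ; pres-𝟎 = has-constant (iso-at 𝟎) false (has-φ 𝟎) =*-refl
      ; pres-𝟏 = has-constant (iso-at 𝟏) true (has-φ 𝟏) =*-refl
      ; pres-⊓ = φ-op₂ _∧_
      ; pres-⊔ = φ-op₂ _∨_
      -- Complement is taken as a binary operation that depends on its first argument.
      ; pres-∁ = λ x → φ-op₂ (λ b _ → not b) x x
      ; comm-σ = λ x → let open Common (common x (σ x)) in
          has-σ (iso-at top) (has-mono x⊑ (has-φ x)) (has-mono y⊑ (has-φ (σ x))) =*-refl }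
      where
      flip : ∀ {L R x y} → Has (L , R) x y → Has (R , L) y x
      flip (i , l , r) = i , r , l

theorem12p3 : ExcludedMiddle → CH →
    (a : ℕ → Subset) → IsElementarySubstructure a →
    (η : Subset → Subset) → IsEmbedding a η →
    Σ (Subset → Subset) λ φ → IsShiftAutomorphism φ × (∀ x → In a x → φ x =* η x)
theorem12p3 em (_≺_ , wf , tri , countable) a elem η emb =
  φ , φ-automorphism , λ x (n , x≈aₙ) → φ-init
    (n , =*-sym x≈aₙ , IsEmbedding.well-defined emb _ _ (n , =*-refl) (n , x≈aₙ) (=*-sym x≈aₙ))
  where
  open Classical em
  -- The recursion starts from the graph of `η` on the enumeration `a`; every stage extends it,
  -- which makes `φ` agree with `η` on 𝔸.
  open Extended (a , η ∘ a) (embedding-≃ elem emb , elementary-rich elem) _≺_ wf tri countable
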